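{- Let $P_{(1,0,1,0)}$ be the set of all cylindric partitions with profile $c=(1,0,1,0)$. Then, as formal power series in $q$, $$\sum_{\Lambda\in P_{(1,0,1,0)}} q^{|\Lambda|}=\left(1+\sum_{n\ge1}\frac{2\,q^{n(n+1)}(-q^2;q^2)_{n-1}}{(q^2;q^2)_n\,(-q;q^2)_n}\right)\frac{(-q;q^2)_\infty}{(q;q)_\infty}.$$
   Context: Let $r,\ell$ be positive integers and $c=(c_1,\dots,c_r)$ a composition of $\ell$ into $r$ nonnegative integer parts (zero entries allowed). A cylindric partition with profile $c$ is a tuple $\Lambda=(\lambda^{(1)},\dots,\lambda^{(r)})$ of ordinary partitions $\lambda^{(i)}=(\lambda^{(i)}_1\ge\lambda^{(i)}_2\ge\cdots)$ (parts beyond the length are taken to be $0$) such that for all $i,j$: $\lambda^{(i)}_j\ge\lambda^{(i+1)}_{j+c_{i+1}}$ for $1\le i\le r-1$, and $\lambda^{(r)}_j\ge\lambda^{(1)}_{j+c_1}$. The size $|\Lambda|$ is the sum of all parts of all $\lambda^{(i)}$; the empty cylindric partition is included with size $0$. Notation: $(a;q)_n=\prod_{k=1}^n(1-aq^{k-1})$ (so $(a;q)_0=1$), $(a;q)_\infty=\lim_{n\to\infty}(a;q)_n$. -}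

module Defs where

open import Data.Nat as ℕ using (ℕ; zero; suc; _≤_; _∸_; _+_; _*_)
open import Data.Integer as ℤ using (ℤ; +_; -_; 0ℤ; 1ℤ; -1ℤ)
open import Data.List as List using (List; []; _∷_; foldr; upTo)
import Data.List.Relation.Unary.All as ListAll
open import Data.List.Relation.Unary.Linked using (Linked)
open import Data.Vec as Vec using (Vec; lookup)
import Data.Nat.ListAction as NL
open import Data.Fin using (Fin; zero; suc)
open import Data.Bool using (if_then_else_)
open import Data.Product using (_×_)
open import Relation.Nullary.Decidable using (⌊_⌋)

IsPartition : List ℕ → Set
IsPartition λs = ListAll.All (λ x → 1 ≤ x) λs × Linked (λ x y → y ≤ x) λs

part : List ℕ → ℕ → ℕ
part []       _       = 0
part (x ∷ _)  zero    = x
part (_ ∷ xs) (suc j) = part xs j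

-- cyclic successor on Fin (suc m): i ↦ i+1, last ↦ zero
next : ∀ {m} → Fin (suc m) → Fin (suc m)
next {zero}  zero    = zero
next {suc m} zero    = suc zero
next {suc m} (suc i) with next {m} i
... | zero  = zero
... | suc j = suc (suc j)

-- Cylindric partition with profile c = (c_1,…,c_r), r = suc m (0-indexed here):
-- λ^(i)_j ≥ λ^(i+1)_{j + c_{i+1}}, indices of λ^(·) and c taken cyclically.
IsCylindric : ∀ {m} → Vec ℕ (suc m) → Vec (List ℕ) (suc m) → Set
IsCylindric c Λ =
  (∀ i → IsPartition (lookup Λ i)) ×
  (∀ i j → part (lookup Λ (next i)) (j + lookup c (next i)) ≤ part (lookup Λ i) j)

size : ∀ {r} → Vec (List ℕ) r → ℕ
size Λ = Vec.sum (Vec.map NL.sum Λ)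

Series : Set
Series = ℕ → ℤ

sumℤ : List ℤ → ℤ
sumℤ = foldr ℤ._+_ 0ℤ

infixl 6 _⊕_ _⊖_
infixl 7 _⊗_ _⊘_

_⊕_ : Series → Series → Series
(f ⊕ g) n = f n ℤ.+ g n

_⊖_ : Series → Series → Series
(f ⊖ g) n = f n ℤ.- g n

_⊗_ : Series → Series → Series
(f ⊗ g) n = sumℤ (List.map (λ k → f k ℤ.* g (n ∸ k)) (upTo (suc n)))

𝟙 : Series
𝟙 zero    = 1ℤ
𝟙 (suc _) = 0ℤ

mono : ℤ → ℕ → Series
mono x m n = if ⌊ m ℕ.≟ n ⌋ then x else 0ℤ

pow : Series → ℕ → Series
pow f zero    = 𝟙
pow f (suc k) = f ⊗ pow f k

prodRange : (ℕ → Series) → ℕ → Series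
prodRange F zero    = 𝟙
prodRange F (suc n) = prodRange F n ⊗ F n

-- Multiplicative inverse of a series with constant term 1:
-- c_0 = 1, c_{n+1} = - Σ_{k=1}^{n+1} f_k c_{n+1-k}.
-- invRev f n = [c_n, c_{n-1}, …, c_0]
private
  weighted : Series → ℕ → List ℤ → ℤ
  weighted f k []       = 0ℤ
  weighted f k (x ∷ xs) = f k ℤ.* x ℤ.+ weighted f (suc k) xs

invRev : Series → ℕ → List ℤ
invRev f zero    = 1ℤ ∷ []
invRev f (suc n) = (- weighted f 1 (invRev f n)) ∷ invRev f n

inv : Series → Series
inv f n with invRev f n
... | []    = 0ℤ
... | x ∷ _ = x

-- division by a series with constant term 1
_⊘_ : Series → Series → Series
f ⊘ g = f ⊗ inv g

poch : Series → Series → ℕ → Series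
poch a b n = prodRange (λ k → 𝟙 ⊖ a ⊗ pow b k) n

-- (a;b)_∞ for a, b of positive valuation: the k-th factor is 1 + O(q^(k+1)),
-- so the coefficient of q^N is that of the finite product over k ≤ N.
pochInf : Series → Series → Series
pochInf a b N = poch a b (suc N) N

q q² -q -q² : Series
q   = mono 1ℤ 1
q²  = mono 1ℤ 2
-q  = mono -1ℤ 1
-q² = mono -1ℤ 2

summand : ℕ → Series
summand n = (mono (+ 2) (n * suc n) ⊗ poch -q² q² (n ∸ 1)) ⊘ (poch q² q² n ⊗ poch -q q² n)

-- 1 + Σ_{n≥1} summand n ; summand n has valuation n(n+1) > N for n > N,
-- so the coefficient of q^N is a finite sum over 1 ≤ n ≤ N.
bracket : Series
bracket N = 𝟙 N ℤ.+ sumℤ (List.map (λ n → summand (suc n) N) (upTo N))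

rhs : Series
rhs = (bracket ⊗ pochInf -q q²) ⊘ pochInf q q

profile : Vec ℕ 4
profile = 1 Vec.∷ 0 Vec.∷ 1 Vec.∷ 0 Vec.∷ Vec.[]

{-# OPTIONS --safe #-}
module Submission where

open import Defs
open import Data.Nat using (ℕ)
open import Data.Integer using (+_)
open import Data.List using (List; length)
open import Data.List.Relation.Unary.All using (All)
open import Data.List.Relation.Unary.Unique.Propositional using (Unique)
open import Data.List.Membership.Propositional using (_∈_)
open import Data.Vec using (Vec)
open import Data.Product using (Σ; _×_)
open import Relation.Binary.PropositionalEquality using (_≡_)

open import Algebra.Bundles using (CommutativeRing)
import Algebra.Properties.AbelianGroup as GroupProperties
import Algebra.Solver.Ring.NaturalCoefficients.Default as SemiringSolver
open import Algebra.Structures using (IsCommutativeRing)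
open import Data.Nat as ℕ using (zero; suc; z≤n; s≤s; _∸_)
import Data.Nat.Properties as ℕ
open import Data.Nat.Tactic.RingSolver using (solve-∀)
import Relation.Binary.Reasoning.Setoid as SetoidReasoning
import Relation.Binary.PropositionalEquality as ≡

-- Fix the profile and let F_c(z) = Σ z^M q^|Λ| over pairs (M , Λ) with all parts of Λ at most M.
-- Either M can be lowered, or some row with c_i > 0 starts with M; removing that part gives profile
-- c - e_i + e_(i+1) and turns z into zq. Up to rotation only the profiles A = (1,0,1,0), B = (1,1,0,0)
-- and C = (2,0,0,0) occur, and inclusion-exclusion gives, for z = q^k,
--   F_A(k) + F_A(k+2) = q^k F_A(k) + 2 F_B(k+1),
--   F_B(k) + F_B(k+2) = q^k F_B(k) + F_A(k+1) + F_C(k+1),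
--   F_C(k) = q^k F_C(k) + F_B(k+1),
-- while the number of Λ of profile A is given by 2 F_B(1) - F_A(2). With α_n and β_n defined by
-- α_0 = β_0 = 1, (1 - q^2n) α_n = 2 q^2n β_(n-1) and β_n = q^2n (α_n + β_(n-1)), the series
--   A(k) = Σ α_n q^kn (-q^(k+2n+1);q²)_∞,  B(k) = Σ β_n q^kn (-q^(k+2n+3);q²)_∞
-- satisfy A(k) = (1 + q^(k+1)) A(k+2) + 2 q^(k+2) B(k+2) and B(k) = A(k+2) + q^(k+2) B(k+2), term by term,
-- so that, for k = j+1, A(j+1), B(j) and B(j+1) divided by (q^(j+1);q)_∞ solve the system for F_A, F_B and F_C.
-- The right-hand side of the theorem is A(0) / (q;q)_∞. Everything is computed modulo q^(N+1), where a solution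
-- is determined by its values for large k.

-- Functional equations of the two series, in an abstract commutative ring.

module _ {c ℓ} (R : CommutativeRing c ℓ) where

  open CommutativeRing R

  -- The parameters stand for `x k` = q^k, `D j` = (-q^j;q²)_∞ and `J j` = 1/(q^(j+1);q)_∞. The
  -- hypothesis `x-nil` expresses computation modulo q^(N+1). All recurrences are written without
  -- subtraction, so that the semiring solver handles them.
  module FunctionalEquations
    (N : ℕ) (x D J α β : ℕ → Carrier)
    (x-0 : x 0 ≈ 1#)
    (x-+ : ∀ j k → x (j ℕ.+ k) ≈ x j * x k)
    (x-nil : ∀ {k} → N ℕ.< k → x k ≈ 0#)
    (D-step : ∀ j → D j ≈ D (2 ℕ.+ j) + x j * D (2 ℕ.+ j))
    (D-far : ∀ {j} → N ℕ.< j → D j ≈ 1#)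
    (J-step : ∀ j → J j ≈ J (suc j) + x (suc j) * J j)
    (J-far : ∀ {j} → N ℕ.< j → J j ≈ 1#)
    (α-0 : α 0 ≈ 1#) (β-0 : β 0 ≈ 1#)
    (α-suc : ∀ n → α (suc n) ≈ x (2 ℕ.* suc n) * (α (suc n) + (β n + β n)))
    (β-suc : ∀ n → β (suc n) ≈ x (2 ℕ.* suc n) * (α (suc n) + β n))
    where

    open SetoidReasoning setoid
    open SemiringSolver commutativeSemiring using (solve; _:=_; _:+_; _:*_)

    ∑ : ℕ → (ℕ → Carrier) → Carrier
    ∑ zero    f = 0#
    ∑ (suc n) f = ∑ n f + f n

    ∑-cong : ∀ n {f g} → (∀ i → f i ≈ g i) → ∑ n f ≈ ∑ n g
    ∑-cong zero    e = refl
    ∑-cong (suc n) e = +-cong (∑-cong n e) (e n)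

    ∑-distribˡ : ∀ n a f → a * ∑ n f ≈ ∑ n (λ i → a * f i)
    ∑-distribˡ zero    a f = zeroʳ a
    ∑-distribˡ (suc n) a f = trans (distribˡ a _ _) (+-congʳ (∑-distribˡ n a f))

    -- The values g 0, ..., g (m-1) are absorbed in f 1, ..., f m. The extra `g m` on the left
    -- completes their sum, so that all three sums have the same length.
    ∑-shift : ∀ m {f g h} → f 0 ≈ h 0 → (∀ n → f (suc n) ≈ h (suc n) + g n) →
              ∑ (suc m) f + g m ≈ ∑ (suc m) h + ∑ (suc m) g
    ∑-shift zero {f} {g} {h} e₀ e = begin
      (0# + f 0) + g 0        ≈⟨ +-cong (+-congˡ e₀) (sym (+-identityˡ _)) ⟩
      (0# + h 0) + (0# + g 0) ∎
    ∑-shift (suc m) {f} {g} {h} e₀ e = begin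
      (∑ (suc m) f + f (suc m)) + g (suc m)           ≈⟨ +-congʳ (+-congˡ (e m)) ⟩
      (∑ (suc m) f + (h (suc m) + g m)) + g (suc m)   ≈⟨ solve 4 (λ a b c d → (a :+ (b :+ c)) :+ d := (a :+ c) :+ (b :+ d)) refl _ _ _ _ ⟩
      (∑ (suc m) f + g m) + (h (suc m) + g (suc m))   ≈⟨ +-congʳ (∑-shift m e₀ e) ⟩
      (∑ (suc m) h + ∑ (suc m) g) + (h (suc m) + g (suc m)) ≈⟨ solve 4 (λ a b c d → (a :+ b) :+ (c :+ d) := (a :+ c) :+ (b :+ d)) refl _ _ _ _ ⟩
      ∑ (suc (suc m)) h + ∑ (suc (suc m)) g           ∎

    ∑-head : ∀ m {f} → (∀ n → f (suc n) ≈ 0#) → ∑ (suc m) f ≈ f 0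
    ∑-head zero    e = +-identityˡ _
    ∑-head (suc m) e = trans (+-cong (∑-head m e) (e m)) (+-identityʳ _)

    x-≡ : ∀ {j k} → j ≡ k → x j ≈ x k
    x-≡ e = reflexive (≡.cong x e)

    D-≡ : ∀ {j k} → j ≡ k → D j ≈ D k
    D-≡ e = reflexive (≡.cong D e)

    a-term b-term : ℕ → ℕ → Carrier
    a-term k n = α n * (x (k ℕ.* n) * D (k ℕ.+ 2 ℕ.* n ℕ.+ 1))
    b-term j n = β n * (x (j ℕ.* n) * D (j ℕ.+ 2 ℕ.* n ℕ.+ 3))

    A B : ℕ → Carrier
    A k = ∑ (suc N) (a-term k)
    B j = ∑ (suc N) (b-term j)

    -- The n-th term of q^(j+2) B(j+2), with the prefactor absorbed into the power of q. It is the
    -- part of term n + 1 of B(j) or A(k) that comes from β_n.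
    b-tail : ℕ → ℕ → Carrier
    b-tail j n = β n * (x ((2 ℕ.+ j) ℕ.* suc n) * D (j ℕ.+ 2 ℕ.* n ℕ.+ 5))

    b-tail-sum : ∀ j → ∑ (suc N) (b-tail j) ≈ x (2 ℕ.+ j) * B (2 ℕ.+ j)
    b-tail-sum j = sym (trans (∑-distribˡ (suc N) _ _) (∑-cong (suc N) λ n → begin
      x (2 ℕ.+ j) * b-term (2 ℕ.+ j) n
        ≈⟨ solve 4 (λ a b c d → a :* (b :* (c :* d)) := b :* ((a :* c) :* d)) refl _ _ _ _ ⟩
      β n * ((x (2 ℕ.+ j) * x ((2 ℕ.+ j) ℕ.* n)) * D (2 ℕ.+ j ℕ.+ 2 ℕ.* n ℕ.+ 3))
        ≈⟨ *-congˡ (*-cong (trans (sym (x-+ _ _)) (x-≡ (≡.sym (ℕ.*-suc (2 ℕ.+ j) n)))) (D-≡ (index j n))) ⟩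
      b-tail j n ∎))
      where
      index : ∀ j n → 2 ℕ.+ j ℕ.+ 2 ℕ.* n ℕ.+ 3 ≡ j ℕ.+ 2 ℕ.* n ℕ.+ 5
      index = solve-∀

    -- The exponent (2 + j)(N + 1) exceeds N, so the boundary term of `∑-shift` dies in the
    -- truncation.
    b-tail-last : ∀ j → b-tail j N ≈ 0#
    b-tail-last j = begin
      β N * (x ((2 ℕ.+ j) ℕ.* suc N) * D _) ≈⟨ *-congˡ (*-congʳ (x-nil (ℕ.m≤m+n (suc N) _))) ⟩
      β N * (0# * D _)                      ≈⟨ *-congˡ (zeroˡ _) ⟩
      β N * 0#                              ≈⟨ zeroʳ _ ⟩
      0#                                    ∎

    ∑-shift-b-tail : ∀ j {f h} → f 0 ≈ h 0 → (∀ n → f (suc n) ≈ h (suc n) + b-tail j n) →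
                     ∑ (suc N) f ≈ ∑ (suc N) h + x (2 ℕ.+ j) * B (2 ℕ.+ j)
    ∑-shift-b-tail j {f} {h} e₀ e = begin
      ∑ (suc N) f                        ≈⟨ +-identityʳ _ ⟨
      ∑ (suc N) f + 0#                   ≈⟨ +-congˡ (b-tail-last j) ⟨
      ∑ (suc N) f + b-tail j N           ≈⟨ ∑-shift N e₀ e ⟩
      ∑ (suc N) h + ∑ (suc N) (b-tail j) ≈⟨ +-congˡ (b-tail-sum j) ⟩
      ∑ (suc N) h + x (2 ℕ.+ j) * B (2 ℕ.+ j) ∎

    -- The recurrence `β-suc` splits each term: its factor q^(2(n+1)) turns q^(j(n+1)) into
    -- q^((j+2)(n+1)), which fits both a term of A(j+2) and the shifted term of B(j+2).
    B-step : ∀ j → B j ≈ A (2 ℕ.+ j) + x (2 ℕ.+ j) * B (2 ℕ.+ j)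
    B-step j = ∑-shift-b-tail j
      (*-cong (trans β-0 (sym α-0)) (*-cong (x-≡ (zero-exponent j)) (D-≡ (index₀ j))))
      λ n → begin
        b-term j (suc n)
          ≈⟨ *-congʳ (β-suc n) ⟩
        x (2 ℕ.* suc n) * (α (suc n) + β n) * (x (j ℕ.* suc n) * D (j ℕ.+ 2 ℕ.* suc n ℕ.+ 3))
          ≈⟨ solve 5 (λ w a b y d → w :* (a :+ b) :* (y :* d) := a :* ((w :* y) :* d) :+ b :* ((w :* y) :* d)) refl _ _ _ _ _ ⟩
        α (suc n) * ((x (2 ℕ.* suc n) * x (j ℕ.* suc n)) * D (j ℕ.+ 2 ℕ.* suc n ℕ.+ 3)) +
        β n * ((x (2 ℕ.* suc n) * x (j ℕ.* suc n)) * D (j ℕ.+ 2 ℕ.* suc n ℕ.+ 3))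
          ≈⟨ +-cong (*-congˡ (*-cong (exponent n) (D-≡ (index₁ j n)))) (*-congˡ (*-cong (exponent n) (D-≡ (index₂ j n)))) ⟩
        a-term (2 ℕ.+ j) (suc n) + b-tail j n ∎
      where
      zero-exponent : ∀ j → j ℕ.* 0 ≡ (2 ℕ.+ j) ℕ.* 0
      zero-exponent = solve-∀
      index₀ : ∀ j → j ℕ.+ 2 ℕ.* 0 ℕ.+ 3 ≡ 2 ℕ.+ j ℕ.+ 2 ℕ.* 0 ℕ.+ 1
      index₀ = solve-∀
      index₁ : ∀ j n → j ℕ.+ 2 ℕ.* suc n ℕ.+ 3 ≡ 2 ℕ.+ j ℕ.+ 2 ℕ.* suc n ℕ.+ 1
      index₁ = solve-∀
      index₂ : ∀ j n → j ℕ.+ 2 ℕ.* suc n ℕ.+ 3 ≡ j ℕ.+ 2 ℕ.* n ℕ.+ 5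
      index₂ = solve-∀
      exponent : ∀ n → x (2 ℕ.* suc n) * x (j ℕ.* suc n) ≈ x ((2 ℕ.+ j) ℕ.* suc n)
      exponent n = trans (sym (x-+ _ _)) (x-≡ (≡.sym (ℕ.*-distribʳ-+ (suc n) 2 j)))

    -- Writing the leading factor of D as 1 + q^(k+2n+1) splits the n-th term in two. The first half
    -- is expanded by `α-suc`; in the second, q^(k+2n+1) = q^(2n) q^(k+1) already supplies the
    -- q^(2n) that changes kn into (k+2)n.
    A-step : ∀ k → A k ≈ (A (2 ℕ.+ k) + x (suc k) * A (2 ℕ.+ k)) +
                         x (2 ℕ.+ k) * B (2 ℕ.+ k) + x (2 ℕ.+ k) * B (2 ℕ.+ k)
    A-step k = begin
      A k ≈⟨ ∑-shift-b-tail k {h = once} head-term tail-term ⟩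
      ∑ (suc N) once + x (2 ℕ.+ k) * B (2 ℕ.+ k)
        ≈⟨ +-congʳ (∑-shift-b-tail k {h = none} refl λ n → refl) ⟩
      ∑ (suc N) none + x (2 ℕ.+ k) * B (2 ℕ.+ k) + x (2 ℕ.+ k) * B (2 ℕ.+ k)
        ≈⟨ +-congʳ (+-congʳ (none-sum (suc N))) ⟩
      (A (2 ℕ.+ k) + x (suc k) * A (2 ℕ.+ k)) + x (2 ℕ.+ k) * B (2 ℕ.+ k) + x (2 ℕ.+ k) * B (2 ℕ.+ k) ∎
      where
      -- Each term contains two copies of `b-tail`, split off one at a time; the names count the
      -- copies still present.
      none once : ℕ → Carrier
      none n = a-term (2 ℕ.+ k) n + x (suc k) * a-term (2 ℕ.+ k) n
      once zero    = none 0
      once (suc n) = none (suc n) + b-tail k n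

      none-sum : ∀ m → ∑ m none ≈ ∑ m (a-term (2 ℕ.+ k)) + x (suc k) * ∑ m (a-term (2 ℕ.+ k))
      none-sum zero    = sym (trans (+-identityˡ _) (zeroʳ _))
      none-sum (suc m) = trans (+-congʳ (none-sum m))
        (solve 3 (λ s t v → (s :+ v :* s) :+ (t :+ v :* t) := (s :+ t) :+ v :* (s :+ t)) refl _ _ _)

      zero-exponent : ∀ k → k ℕ.* 0 ≡ (2 ℕ.+ k) ℕ.* 0
      zero-exponent = solve-∀
      index₀ : ∀ k → k ℕ.+ 2 ℕ.* 0 ℕ.+ 1 ≡ suc k
      index₀ = solve-∀
      index₁ : ∀ k → 2 ℕ.+ suc k ≡ 2 ℕ.+ k ℕ.+ 2 ℕ.* 0 ℕ.+ 1
      index₁ = solve-∀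
      index₂ : ∀ k n → 2 ℕ.+ (k ℕ.+ 2 ℕ.* suc n ℕ.+ 1) ≡ k ℕ.+ 2 ℕ.* n ℕ.+ 5
      index₂ = solve-∀
      index₃ : ∀ k n → 2 ℕ.+ k ℕ.+ 2 ℕ.* suc n ℕ.+ 1 ≡ k ℕ.+ 2 ℕ.* n ℕ.+ 5
      index₃ = solve-∀
      index₄ : ∀ k n → k ℕ.+ 2 ℕ.* suc n ℕ.+ 1 ≡ 2 ℕ.* suc n ℕ.+ suc k
      index₄ = solve-∀

      head-term : a-term k 0 ≈ once 0
      head-term = begin
        α 0 * (x (k ℕ.* 0) * D (k ℕ.+ 2 ℕ.* 0 ℕ.+ 1))
          ≈⟨ *-congˡ (*-cong (x-≡ (zero-exponent k)) (trans (D-≡ (index₀ k)) (D-step (suc k)))) ⟩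
        α 0 * (x ((2 ℕ.+ k) ℕ.* 0) * (D (2 ℕ.+ suc k) + x (suc k) * D (2 ℕ.+ suc k)))
          ≈⟨ solve 4 (λ a y d v → a :* (y :* (d :+ v :* d)) := a :* (y :* d) :+ v :* (a :* (y :* d))) refl _ _ _ _ ⟩
        α 0 * (x ((2 ℕ.+ k) ℕ.* 0) * D (2 ℕ.+ suc k)) + x (suc k) * (α 0 * (x ((2 ℕ.+ k) ℕ.* 0) * D (2 ℕ.+ suc k)))
          ≈⟨ +-cong step (*-congˡ step) ⟩
        once 0 ∎
        where
        step : α 0 * (x ((2 ℕ.+ k) ℕ.* 0) * D (2 ℕ.+ suc k)) ≈ a-term (2 ℕ.+ k) 0
        step = *-congˡ (*-congˡ (D-≡ (index₁ k)))

      tail-term : ∀ n → a-term k (suc n) ≈ once (suc n) + b-tail k n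
      tail-term n = begin
        α (suc n) * (y * D (k ℕ.+ 2 ℕ.* suc n ℕ.+ 1))
          ≈⟨ *-congˡ (*-congˡ (D-step _)) ⟩
        α (suc n) * (y * (D (2 ℕ.+ (k ℕ.+ 2 ℕ.* suc n ℕ.+ 1)) + x (k ℕ.+ 2 ℕ.* suc n ℕ.+ 1) * D (2 ℕ.+ (k ℕ.+ 2 ℕ.* suc n ℕ.+ 1))))
          ≈⟨ *-congˡ (*-congˡ (+-cong (D-≡ (index₂ k n)) (*-cong (trans (x-≡ (index₄ k n)) (x-+ _ _)) (D-≡ (index₂ k n))))) ⟩
        α (suc n) * (y * (d + (w * v) * d))
          ≈⟨ solve 5 (λ a y d w v → a :* (y :* (d :+ (w :* v) :* d)) := a :* (y :* d) :+ v :* (a :* ((w :* y) :* d))) refl _ _ _ _ _ ⟩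
        α (suc n) * (y * d) + v * (α (suc n) * ((w * y) * d))
          ≈⟨ +-congʳ (*-congʳ (α-suc n)) ⟩
        (w * (α (suc n) + (β n + β n))) * (y * d) + v * (α (suc n) * ((w * y) * d))
          ≈⟨ solve 6 (λ a b y d w v → (w :* (a :+ (b :+ b))) :* (y :* d) :+ v :* (a :* ((w :* y) :* d)) :=
               ((a :* ((w :* y) :* d) :+ v :* (a :* ((w :* y) :* d))) :+ b :* ((w :* y) :* d)) :+ b :* ((w :* y) :* d)) refl _ _ _ _ _ _ ⟩
        ((α (suc n) * ((w * y) * d) + v * (α (suc n) * ((w * y) * d))) + β n * ((w * y) * d)) + β n * ((w * y) * d)
          ≈⟨ +-cong (+-cong (+-cong a-part (*-congˡ a-part)) b-part) b-part ⟩
        once (suc n) + b-tail k n ∎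
        where
        d y w v : Carrier
        d = D (k ℕ.+ 2 ℕ.* n ℕ.+ 5)
        y = x (k ℕ.* suc n)
        w = x (2 ℕ.* suc n)
        v = x (suc k)
        exponent : w * y ≈ x ((2 ℕ.+ k) ℕ.* suc n)
        exponent = trans (sym (x-+ _ _)) (x-≡ (≡.sym (ℕ.*-distribʳ-+ (suc n) 2 k)))
        a-part : α (suc n) * ((w * y) * d) ≈ a-term (2 ℕ.+ k) (suc n)
        a-part = *-congˡ (*-cong exponent (D-≡ (≡.sym (index₃ k n))))
        b-part : β n * ((w * y) * d) ≈ b-tail k n
        b-part = *-congˡ (*-congʳ exponent)

    -- Eliminates q^(k+2) B(k+2) between `A-step` and twice `B-step`.
    A-B : ∀ k → A k + A (2 ℕ.+ k) ≈ (B k + B k) + x (suc k) * A (2 ℕ.+ k)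
    A-B k = begin
      A k + A (2 ℕ.+ k)
        ≈⟨ +-congʳ (A-step k) ⟩
      ((A (2 ℕ.+ k) + x (suc k) * A (2 ℕ.+ k)) + x (2 ℕ.+ k) * B (2 ℕ.+ k) + x (2 ℕ.+ k) * B (2 ℕ.+ k)) + A (2 ℕ.+ k)
        ≈⟨ solve 3 (λ a b v → ((a :+ v) :+ b :+ b) :+ a := ((a :+ b) :+ (a :+ b)) :+ v) refl _ _ _ ⟩
      ((A (2 ℕ.+ k) + x (2 ℕ.+ k) * B (2 ℕ.+ k)) + (A (2 ℕ.+ k) + x (2 ℕ.+ k) * B (2 ℕ.+ k))) + x (suc k) * A (2 ℕ.+ k)
        ≈⟨ +-congʳ (+-cong (B-step k) (B-step k)) ⟨
      (B k + B k) + x (suc k) * A (2 ℕ.+ k) ∎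

    -- The candidates for F_A, F_B and F_C at z = q^(j+1). The index is shifted because z = 1 is
    -- excluded: there every M would have weight zero.
    φA φB φC : ℕ → Carrier
    φA j = A (suc j) * J j
    φB j = B j * J j
    φC j = B (suc j) * J j

    *J-step : ∀ a j → a * J j ≈ a * J (suc j) + x (suc j) * (a * J j)
    *J-step a j = trans (*-congˡ (J-step j))
      (solve 4 (λ a p v r → a :* (p :+ v :* r) := a :* p :+ v :* (a :* r)) refl _ _ _ _)

    -- For j = 0 this says that A(0)/(q;q)_∞ = 2 F_B(1) - F_A(2); for larger j it yields the
    -- equation for F_A. It is `A-B` times `J j`, with q^(j+1) A(j+2) `J j` cancelled from both
    -- sides.
    A-J : ∀ j → A j * J j + φA (suc j) ≈ φB j + φB j
    A-J j = +-cancelʳ (x (suc j) * (A (2 ℕ.+ j) * J j)) _ _ (begin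
      A j * J j + φA (suc j) + x (suc j) * (A (2 ℕ.+ j) * J j)   ≈⟨ +-assoc _ _ _ ⟩
      A j * J j + (φA (suc j) + x (suc j) * (A (2 ℕ.+ j) * J j)) ≈⟨ +-congˡ (*J-step _ j) ⟨
      A j * J j + A (2 ℕ.+ j) * J j                              ≈⟨ distribʳ _ _ _ ⟨
      (A j + A (2 ℕ.+ j)) * J j                                  ≈⟨ *-congʳ (A-B j) ⟩
      ((B j + B j) + x (suc j) * A (2 ℕ.+ j)) * J j
        ≈⟨ solve 4 (λ b v a r → ((b :+ b) :+ v :* a) :* r := (b :* r :+ b :* r) :+ v :* (a :* r)) refl _ _ _ _ ⟩
      φB j + φB j + x (suc j) * (A (2 ℕ.+ j) * J j)              ∎)
      where open GroupProperties +-abelianGroup using () renaming (∙-cancelʳ to +-cancelʳ)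

    φA-step : ∀ j → φA j + φA (2 ℕ.+ j) ≈ x (suc j) * φA j + (φB (suc j) + φB (suc j))
    φA-step j = begin
      φA j + φA (2 ℕ.+ j)
        ≈⟨ +-congʳ (*J-step _ j) ⟩
      (A (suc j) * J (suc j) + x (suc j) * φA j) + φA (2 ℕ.+ j)
        ≈⟨ solve 3 (λ a b c → (a :+ b) :+ c := b :+ (a :+ c)) refl _ _ _ ⟩
      x (suc j) * φA j + (A (suc j) * J (suc j) + φA (2 ℕ.+ j))
        ≈⟨ +-congˡ (A-J (suc j)) ⟩
      x (suc j) * φA j + (φB (suc j) + φB (suc j)) ∎

    -- After `B-step`, the term q^(j+2) B(j+2) `J (suc j)` joins `φB (2 ℕ.+ j)` to give
    -- `φC (suc j)`, by the recurrence of J at j + 1.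
    φB-step : ∀ j → φB j + φB (2 ℕ.+ j) ≈ x (suc j) * φB j + (φA (suc j) + φC (suc j))
    φB-step j = begin
      φB j + φB (2 ℕ.+ j)
        ≈⟨ +-congʳ (*J-step _ j) ⟩
      (B j * J (suc j) + x (suc j) * φB j) + φB (2 ℕ.+ j)
        ≈⟨ +-congʳ (+-congʳ (*-congʳ (B-step j))) ⟩
      ((A (2 ℕ.+ j) + x (2 ℕ.+ j) * B (2 ℕ.+ j)) * J (suc j) + x (suc j) * φB j) + φB (2 ℕ.+ j)
        ≈⟨ solve 6 (λ a v b r s t → ((a :+ v :* b) :* r :+ s) :+ t := s :+ (a :* r :+ (t :+ v :* (b :* r)))) refl _ _ _ _ _ _ ⟩
      x (suc j) * φB j + (φA (suc j) + (φB (2 ℕ.+ j) + x (2 ℕ.+ j) * φC (suc j)))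
        ≈⟨ +-congˡ (+-congˡ (*J-step _ (suc j))) ⟨
      x (suc j) * φB j + (φA (suc j) + φC (suc j)) ∎

    φC-step : ∀ j → φC j ≈ x (suc j) * φC j + φB (suc j)
    φC-step j = trans (*J-step _ j) (+-comm _ _)

    x-far-multiple : ∀ {k} n → N ℕ.< k → x (k ℕ.* suc n) ≈ 0#
    x-far-multiple {k} n N<k = x-nil (ℕ.≤-trans N<k (ℕ.m≤m*n k (suc n)))

    x-*0 : ∀ k → x (k ℕ.* 0) ≈ 1#
    x-*0 k = trans (x-≡ (ℕ.*-zeroʳ k)) x-0

    far-product : ∀ {a y d} → a ≈ 1# → y ≈ 1# → d ≈ 1# → a * (y * d) ≈ 1#
    far-product ea ey ed = trans (*-cong ea (trans (*-cong ey ed) (*-identityˡ _))) (*-identityˡ _)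

    far-zero : ∀ {a y d} → y ≈ 0# → a * (y * d) ≈ 0#
    far-zero ey = trans (*-congˡ (trans (*-congʳ ey) (zeroˡ _))) (zeroʳ _)

    -- Only the term n = 0 survives the truncation, and each of its factors is 1.
    A-far : ∀ {k} → N ℕ.< k → A k ≈ 1#
    A-far {k} N<k = trans (∑-head N (λ n → far-zero (x-far-multiple n N<k)))
      (far-product α-0 (x-*0 k) (D-far (ℕ.≤-trans N<k (ℕ.≤-trans (ℕ.m≤m+n k _) (ℕ.m≤m+n _ 1)))))

    B-far : ∀ {j} → N ℕ.< j → B j ≈ 1#
    B-far {j} N<j = trans (∑-head N (λ n → far-zero (x-far-multiple n N<j)))
      (far-product β-0 (x-*0 j) (D-far (ℕ.≤-trans N<j (ℕ.≤-trans (ℕ.m≤m+n j _) (ℕ.m≤m+n _ 3)))))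

    φA-far : ∀ {j} → N ℕ.< j → φA j ≈ 1#
    φA-far N<j = trans (*-cong (A-far (ℕ.m≤n⇒m≤1+n N<j)) (J-far N<j)) (*-identityˡ _)

    φB-far : ∀ {j} → N ℕ.< j → φB j ≈ 1#
    φB-far N<j = trans (*-cong (B-far N<j) (J-far N<j)) (*-identityˡ _)

    φC-far : ∀ {j} → N ℕ.< j → φC j ≈ 1#
    φC-far N<j = trans (*-cong (B-far (ℕ.m≤n⇒m≤1+n N<j)) (J-far N<j)) (*-identityˡ _)

open import Data.Bool using (if_then_else_)
open import Data.Fin using (zero; suc)
open import Data.Integer as ℤ using (ℤ; 0ℤ; 1ℤ; -1ℤ)
import Data.Integer.Properties as ℤ
import Data.Integer.Tactic.RingSolver as ℤSolver
open import Data.List as List using ([]; _∷_; applyUpTo; map; _++_; filter)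
import Data.List.Properties as List
open import Data.List.Membership.Propositional.Properties using (∈-map⁺; ∈-++⁺ˡ; ∈-++⁺ʳ; ∈-++⁻; ∈-filter⁺; ∈-filter⁻)
open import Data.List.Membership.Propositional.Properties.WithK using (unique∧set⇒bag)
open import Data.List.Relation.Binary.BagAndSetEquality using (∼bag⇒↭)
open import Data.List.Relation.Binary.Permutation.Propositional.Properties using (↭-length)
open import Data.List.Relation.Unary.All as All using ([]; _∷_)
import Data.List.Relation.Unary.All.Properties as All
open import Data.List.Relation.Unary.AllPairs using ([]; _∷_)
open import Data.List.Relation.Unary.Any using (here)
open import Data.List.Relation.Unary.Linked using ([]; [-]; _∷_)
import Data.List.Relation.Unary.Unique.Propositional.Properties as Unique
open import Data.Nat using (_≤_; _<_; _+_; _*_; _⊔_)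
import Data.Nat.ListAction as ℕ
open import Data.Product using (_,_; proj₁; proj₂)
open import Data.Sum using (_⊎_; inj₁; inj₂; [_,_]′)
open import Data.Unit using (⊤; tt)
open import Data.Vec using ([]; _∷_)
open import Function using (_∘_; mk⇔; case_of_)
open import Level using (0ℓ)
open import Relation.Binary.PropositionalEquality using (refl; sym; trans; cong; cong₂; subst)
open import Relation.Binary.Structures using (IsEquivalence)
open import Relation.Nullary using (¬_; yes; no; contradiction; ¬?)
open import Relation.Nullary.Decidable using (_⊎-dec_; isYes≗does)
open import Relation.Unary using (Decidable; _∩_; _∪_)

-- The ring of formal power series under convolution.

infix 4 _≗ₛ_
_≗ₛ_ : Series → Series → Set
f ≗ₛ g = ∀ n → f n ≡ g n

𝟘 : Series
𝟘 n = 0ℤ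

⊝_ : Series → Series
(⊝ f) n = ℤ.- f n

module _ where
  open ≡.≡-Reasoning

  -- Unlike a `map` over `upTo`, `applyUpTo` unfolds so that the tail of the sum is literally a
  -- convolution with `f ∘ suc`.
  conv : Series → Series → ℕ → ℤ
  conv f g n = sumℤ (applyUpTo (λ k → f k ℤ.* g (n ∸ k)) (suc n))

  ⊗-conv : ∀ f g → f ⊗ g ≗ₛ conv f g
  ⊗-conv f g n = cong sumℤ (List.map-upTo (λ k → f k ℤ.* g (n ∸ k)) (suc n))

  ⊗-zero : ∀ f g → (f ⊗ g) 0 ≡ f 0 ℤ.* g 0
  ⊗-zero f g = ℤ.+-identityʳ _

  -- Corresponds to writing f as f(0) + q f'. The ring laws below follow from it by induction on the
  -- coefficient.
  ⊗-suc : ∀ f g n → (f ⊗ g) (suc n) ≡ f 0 ℤ.* g (suc n) ℤ.+ ((f ∘ suc) ⊗ g) n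
  ⊗-suc f g n = trans (⊗-conv f g (suc n)) (cong (ℤ._+_ (f 0 ℤ.* g (suc n))) (sym (⊗-conv (f ∘ suc) g n)))

  -- Coefficient n of a product sees only coefficients up to n of the factors. This makes truncation
  -- compatible with products and also stands in for function extensionality.
  ⊗-cong-≤ : ∀ n {f f′ g g′} → (∀ {m} → m ℕ.≤ n → f m ≡ f′ m) → (∀ {m} → m ℕ.≤ n → g m ≡ g′ m) →
             (f ⊗ g) n ≡ (f′ ⊗ g′) n
  ⊗-cong-≤ zero {f} {f′} {g} {g′} ef eg =
    trans (⊗-zero f g) (trans (cong₂ ℤ._*_ (ef z≤n) (eg z≤n)) (sym (⊗-zero f′ g′)))
  ⊗-cong-≤ (suc n) {f} {f′} {g} {g′} ef eg = begin
    (f ⊗ g) (suc n)                                    ≡⟨ ⊗-suc f g n ⟩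
    f 0 ℤ.* g (suc n) ℤ.+ ((f ∘ suc) ⊗ g) n
      ≡⟨ cong₂ ℤ._+_ (cong₂ ℤ._*_ (ef z≤n) (eg ℕ.≤-refl)) (⊗-cong-≤ n (ef ∘ s≤s) (eg ∘ ℕ.m≤n⇒m≤1+n)) ⟩
    f′ 0 ℤ.* g′ (suc n) ℤ.+ ((f′ ∘ suc) ⊗ g′) n ≡⟨ ⊗-suc f′ g′ n ⟨
    (f′ ⊗ g′) (suc n)                                  ∎

  ⊗-distribʳ : ∀ h f g → (f ⊕ g) ⊗ h ≗ₛ (f ⊗ h) ⊕ (g ⊗ h)
  ⊗-distribʳ h f g zero = begin
    ((f ⊕ g) ⊗ h) 0               ≡⟨ ⊗-zero (f ⊕ g) h ⟩
    (f 0 ℤ.+ g 0) ℤ.* h 0           ≡⟨ ℤ.*-distribʳ-+ (h 0) (f 0) (g 0) ⟩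
    f 0 ℤ.* h 0 ℤ.+ g 0 ℤ.* h 0     ≡⟨ cong₂ ℤ._+_ (⊗-zero f h) (⊗-zero g h) ⟨
    ((f ⊗ h) ⊕ (g ⊗ h)) 0           ∎
  ⊗-distribʳ h f g (suc n) = begin
    ((f ⊕ g) ⊗ h) (suc n)
      ≡⟨ ⊗-suc (f ⊕ g) h n ⟩
    (f 0 ℤ.+ g 0) ℤ.* h (suc n) ℤ.+ (((f ∘ suc) ⊕ (g ∘ suc)) ⊗ h) n
      ≡⟨ cong (ℤ._+_ ((f 0 ℤ.+ g 0) ℤ.* h (suc n))) (⊗-distribʳ h (f ∘ suc) (g ∘ suc) n) ⟩
    (f 0 ℤ.+ g 0) ℤ.* h (suc n) ℤ.+ (((f ∘ suc) ⊗ h) n ℤ.+ ((g ∘ suc) ⊗ h) n)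
      ≡⟨ regroup (f 0) (g 0) (h (suc n)) _ _ ⟩
    (f 0 ℤ.* h (suc n) ℤ.+ ((f ∘ suc) ⊗ h) n) ℤ.+ (g 0 ℤ.* h (suc n) ℤ.+ ((g ∘ suc) ⊗ h) n)
      ≡⟨ cong₂ ℤ._+_ (⊗-suc f h n) (⊗-suc g h n) ⟨
    ((f ⊗ h) ⊕ (g ⊗ h)) (suc n) ∎
    where
    regroup : ∀ a b c d e → (a ℤ.+ b) ℤ.* c ℤ.+ (d ℤ.+ e) ≡ (a ℤ.* c ℤ.+ d) ℤ.+ (b ℤ.* c ℤ.+ e)
    regroup = ℤSolver.solve-∀

  ⊗-scaleˡ : ∀ a f g → (λ m → a ℤ.* f m) ⊗ g ≗ₛ λ n → a ℤ.* (f ⊗ g) n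
  ⊗-scaleˡ a f g zero = begin
    ((λ m → a ℤ.* f m) ⊗ g) 0 ≡⟨ ⊗-zero (λ m → a ℤ.* f m) g ⟩
    a ℤ.* f 0 ℤ.* g 0         ≡⟨ ℤ.*-assoc a (f 0) (g 0) ⟩
    a ℤ.* (f 0 ℤ.* g 0)       ≡⟨ cong (a ℤ.*_) (⊗-zero f g) ⟨
    a ℤ.* (f ⊗ g) 0           ∎
  ⊗-scaleˡ a f g (suc n) = begin
    ((λ m → a ℤ.* f m) ⊗ g) (suc n)
      ≡⟨ ⊗-suc (λ m → a ℤ.* f m) g n ⟩
    a ℤ.* f 0 ℤ.* g (suc n) ℤ.+ ((λ m → a ℤ.* f (suc m)) ⊗ g) n
      ≡⟨ cong (ℤ._+_ (a ℤ.* f 0 ℤ.* g (suc n))) (⊗-scaleˡ a (f ∘ suc) g n) ⟩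
    a ℤ.* f 0 ℤ.* g (suc n) ℤ.+ a ℤ.* ((f ∘ suc) ⊗ g) n
      ≡⟨ factor a (f 0) (g (suc n)) _ ⟩
    a ℤ.* (f 0 ℤ.* g (suc n) ℤ.+ ((f ∘ suc) ⊗ g) n)
      ≡⟨ cong (a ℤ.*_) (⊗-suc f g n) ⟨
    a ℤ.* (f ⊗ g) (suc n) ∎
    where
    factor : ∀ a b c d → a ℤ.* b ℤ.* c ℤ.+ a ℤ.* d ≡ a ℤ.* (b ℤ.* c ℤ.+ d)
    factor = ℤSolver.solve-∀

  ⊗-assoc : ∀ f g h → (f ⊗ g) ⊗ h ≗ₛ f ⊗ (g ⊗ h)
  ⊗-assoc f g h zero = begin
    ((f ⊗ g) ⊗ h) 0         ≡⟨ ⊗-zero (f ⊗ g) h ⟩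
    (f ⊗ g) 0 ℤ.* h 0       ≡⟨ cong (ℤ._* h 0) (⊗-zero f g) ⟩
    f 0 ℤ.* g 0 ℤ.* h 0     ≡⟨ ℤ.*-assoc (f 0) (g 0) (h 0) ⟩
    f 0 ℤ.* (g 0 ℤ.* h 0)   ≡⟨ cong (f 0 ℤ.*_) (⊗-zero g h) ⟨
    f 0 ℤ.* (g ⊗ h) 0       ≡⟨ ⊗-zero f (g ⊗ h) ⟨
    (f ⊗ (g ⊗ h)) 0         ∎
  ⊗-assoc f g h (suc n) = begin
    ((f ⊗ g) ⊗ h) (suc n)
      ≡⟨ ⊗-suc (f ⊗ g) h n ⟩
    (f ⊗ g) 0 ℤ.* h (suc n) ℤ.+ (((f ⊗ g) ∘ suc) ⊗ h) n
      ≡⟨ cong₂ ℤ._+_ (cong (ℤ._* h (suc n)) (⊗-zero f g)) tail ⟩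
    f 0 ℤ.* g 0 ℤ.* h (suc n) ℤ.+ (f 0 ℤ.* ((g ∘ suc) ⊗ h) n ℤ.+ ((f ∘ suc) ⊗ (g ⊗ h)) n)
      ≡⟨ regroup (f 0) (g 0) (h (suc n)) _ _ ⟩
    f 0 ℤ.* (g 0 ℤ.* h (suc n) ℤ.+ ((g ∘ suc) ⊗ h) n) ℤ.+ ((f ∘ suc) ⊗ (g ⊗ h)) n
      ≡⟨ cong (λ z → f 0 ℤ.* z ℤ.+ ((f ∘ suc) ⊗ (g ⊗ h)) n) (⊗-suc g h n) ⟨
    f 0 ℤ.* (g ⊗ h) (suc n) ℤ.+ ((f ∘ suc) ⊗ (g ⊗ h)) n
      ≡⟨ ⊗-suc f (g ⊗ h) n ⟨
    (f ⊗ (g ⊗ h)) (suc n) ∎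
    where
    regroup : ∀ a b c d e → a ℤ.* b ℤ.* c ℤ.+ (a ℤ.* d ℤ.+ e) ≡ a ℤ.* (b ℤ.* c ℤ.+ d) ℤ.+ e
    regroup = ℤSolver.solve-∀
    -- The shift of `f ⊗ g` is f(0) times the shift of g plus (the shift of f) `⊗ g`, so
    -- distributivity and the induction hypothesis apply.
    tail : (((f ⊗ g) ∘ suc) ⊗ h) n ≡ f 0 ℤ.* ((g ∘ suc) ⊗ h) n ℤ.+ ((f ∘ suc) ⊗ (g ⊗ h)) n
    tail = begin
      (((f ⊗ g) ∘ suc) ⊗ h) n
        ≡⟨ ⊗-cong-≤ n {g = h} (λ {m} _ → ⊗-suc f g m) (λ _ → refl) ⟩
      (((λ m → f 0 ℤ.* g (suc m)) ⊕ ((f ∘ suc) ⊗ g)) ⊗ h) n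
        ≡⟨ ⊗-distribʳ h (λ m → f 0 ℤ.* g (suc m)) ((f ∘ suc) ⊗ g) n ⟩
      ((λ m → f 0 ℤ.* g (suc m)) ⊗ h) n ℤ.+ (((f ∘ suc) ⊗ g) ⊗ h) n
        ≡⟨ cong₂ ℤ._+_ (⊗-scaleˡ (f 0) (g ∘ suc) h n) (⊗-assoc (f ∘ suc) g h n) ⟩
      f 0 ℤ.* ((g ∘ suc) ⊗ h) n ℤ.+ ((f ∘ suc) ⊗ (g ⊗ h)) n ∎

  -- The mirror image of `⊗-suc`, peeling the right factor; comparing the two gives commutativity.
  ⊗-sucʳ : ∀ f g n → (f ⊗ g) (suc n) ≡ g 0 ℤ.* f (suc n) ℤ.+ (f ⊗ (g ∘ suc)) n
  ⊗-sucʳ f g zero = begin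
    (f ⊗ g) 1                             ≡⟨ ⊗-suc f g 0 ⟩
    f 0 ℤ.* g 1 ℤ.+ ((f ∘ suc) ⊗ g) 0     ≡⟨ cong (ℤ._+_ (f 0 ℤ.* g 1)) (⊗-zero (f ∘ suc) g) ⟩
    f 0 ℤ.* g 1 ℤ.+ f 1 ℤ.* g 0           ≡⟨ swap (f 0) (g 1) (f 1) (g 0) ⟩
    g 0 ℤ.* f 1 ℤ.+ f 0 ℤ.* g 1           ≡⟨ cong (ℤ._+_ (g 0 ℤ.* f 1)) (⊗-zero f (g ∘ suc)) ⟨
    g 0 ℤ.* f 1 ℤ.+ (f ⊗ (g ∘ suc)) 0     ∎
    where
    swap : ∀ a b c d → a ℤ.* b ℤ.+ c ℤ.* d ≡ d ℤ.* c ℤ.+ a ℤ.* b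
    swap = ℤSolver.solve-∀
  ⊗-sucʳ f g (suc n) = begin
    (f ⊗ g) (2 ℕ.+ n)
      ≡⟨ ⊗-suc f g (suc n) ⟩
    f 0 ℤ.* g (2 ℕ.+ n) ℤ.+ ((f ∘ suc) ⊗ g) (suc n)
      ≡⟨ cong (ℤ._+_ (f 0 ℤ.* g (2 ℕ.+ n))) (⊗-sucʳ (f ∘ suc) g n) ⟩
    f 0 ℤ.* g (2 ℕ.+ n) ℤ.+ (g 0 ℤ.* f (2 ℕ.+ n) ℤ.+ ((f ∘ suc) ⊗ (g ∘ suc)) n)
      ≡⟨ swap (f 0 ℤ.* g (2 ℕ.+ n)) (g 0 ℤ.* f (2 ℕ.+ n)) _ ⟩
    g 0 ℤ.* f (2 ℕ.+ n) ℤ.+ (f 0 ℤ.* g (2 ℕ.+ n) ℤ.+ ((f ∘ suc) ⊗ (g ∘ suc)) n)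
      ≡⟨ cong (ℤ._+_ (g 0 ℤ.* f (2 ℕ.+ n))) (⊗-suc f (g ∘ suc) n) ⟨
    g 0 ℤ.* f (2 ℕ.+ n) ℤ.+ (f ⊗ (g ∘ suc)) (suc n) ∎
    where
    swap : ∀ a b c → a ℤ.+ (b ℤ.+ c) ≡ b ℤ.+ (a ℤ.+ c)
    swap = ℤSolver.solve-∀

  ⊗-comm : ∀ f g → f ⊗ g ≗ₛ g ⊗ f
  ⊗-comm f g zero    = trans (⊗-zero f g) (trans (ℤ.*-comm (f 0) (g 0)) (sym (⊗-zero g f)))
  ⊗-comm f g (suc n) = begin
    (f ⊗ g) (suc n)                          ≡⟨ ⊗-suc f g n ⟩
    f 0 ℤ.* g (suc n) ℤ.+ ((f ∘ suc) ⊗ g) n  ≡⟨ cong (ℤ._+_ (f 0 ℤ.* g (suc n))) (⊗-comm (f ∘ suc) g n) ⟩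
    f 0 ℤ.* g (suc n) ℤ.+ (g ⊗ (f ∘ suc)) n  ≡⟨ ⊗-sucʳ g f n ⟨
    (g ⊗ f) (suc n)                          ∎

  𝟘⊗ : ∀ g → 𝟘 ⊗ g ≗ₛ 𝟘
  𝟘⊗ g zero    = ⊗-zero 𝟘 g
  𝟘⊗ g (suc n) = trans (⊗-suc 𝟘 g n) (trans (ℤ.+-identityˡ _) (𝟘⊗ g n))

  𝟙⊗ : ∀ g → 𝟙 ⊗ g ≗ₛ g
  𝟙⊗ g zero    = trans (⊗-zero 𝟙 g) (ℤ.*-identityˡ (g 0))
  𝟙⊗ g (suc n) = trans (⊗-suc 𝟙 g n) (trans (cong₂ ℤ._+_ (ℤ.*-identityˡ (g (suc n))) (𝟘⊗ g n)) (ℤ.+-identityʳ _))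

  -- `weighted` is private in Defs, so it is obtained as the solution of the metavariable in `weightedSum`:
  -- abstracting over 1 and `invRev f n` turns `inv-suc` into a pattern unification problem.
  mutual
    weightedSum : Series → ℕ → List ℤ → ℤ
    weightedSum f k xs = _

    inv-suc : ∀ f n → inv f (suc n) ≡ ℤ.- weightedSum f 1 (invRev f n)
    inv-suc f n with 1 | invRev f n
    ... | k | xs = weightedSum-determined f k xs

    weightedSum-determined : ∀ f k xs → _ ≡ ℤ.- weightedSum f k xs
    weightedSum-determined f k xs = refl {x = ℤ.- weightedSum f k xs}

  -- The list runs from coefficient n down to 0 while the index of f runs upwards from k, which is a
  -- convolution. The offset k is arbitrary for the induction; k = 1 gives the recursion of `inv`.
  weightedSum-invRev : ∀ f g k n → weightedSum f k (invRev g n) ≡ ((λ m → f (k ℕ.+ m)) ⊗ inv g) n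
  weightedSum-invRev f g k zero =
    trans (cong (λ j → f j ℤ.* 1ℤ ℤ.+ 0ℤ) (sym (ℕ.+-identityʳ k))) refl
  weightedSum-invRev f g k (suc n) = begin
    f k ℤ.* inv g (suc n) ℤ.+ weightedSum f (suc k) (invRev g n)
      ≡⟨ cong₂ (λ j s → f j ℤ.* inv g (suc n) ℤ.+ s) (sym (ℕ.+-identityʳ k)) (weightedSum-invRev f g (suc k) n) ⟩
    f (k ℕ.+ 0) ℤ.* inv g (suc n) ℤ.+ ((λ m → f (suc k ℕ.+ m)) ⊗ inv g) n
      ≡⟨ cong (ℤ._+_ (f (k ℕ.+ 0) ℤ.* inv g (suc n))) (⊗-cong-≤ n {g = inv g} (λ {m} _ → cong f (sym (ℕ.+-suc k m))) (λ _ → refl)) ⟩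
    f (k ℕ.+ 0) ℤ.* inv g (suc n) ℤ.+ ((λ m → f (k ℕ.+ suc m)) ⊗ inv g) n
      ≡⟨ ⊗-suc (λ m → f (k ℕ.+ m)) (inv g) n ⟨
    ((λ m → f (k ℕ.+ m)) ⊗ inv g) (suc n) ∎

  ⊗-inverseʳ : ∀ f → f 0 ≡ 1ℤ → f ⊗ inv f ≗ₛ 𝟙
  ⊗-inverseʳ f f₀ zero    = trans (⊗-zero f (inv f)) (trans (ℤ.*-identityʳ (f 0)) f₀)
  ⊗-inverseʳ f f₀ (suc n) = begin
    (f ⊗ inv f) (suc n)                                   ≡⟨ ⊗-suc f (inv f) n ⟩
    f 0 ℤ.* inv f (suc n) ℤ.+ ((f ∘ suc) ⊗ inv f) n
      ≡⟨ cong₂ (λ a b → a ℤ.* b ℤ.+ ((f ∘ suc) ⊗ inv f) n) f₀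
           (trans (inv-suc f n) (cong ℤ.-_ (weightedSum-invRev f f 1 n))) ⟩
    1ℤ ℤ.* (ℤ.- ((f ∘ suc) ⊗ inv f) n) ℤ.+ ((f ∘ suc) ⊗ inv f) n
      ≡⟨ cong (ℤ._+ ((f ∘ suc) ⊗ inv f) n) (ℤ.*-identityˡ (ℤ.- ((f ∘ suc) ⊗ inv f) n)) ⟩
    ℤ.- ((f ∘ suc) ⊗ inv f) n ℤ.+ ((f ∘ suc) ⊗ inv f) n
      ≡⟨ ℤ.+-inverseˡ (((f ∘ suc) ⊗ inv f) n) ⟩
    0ℤ ∎

-- Power series modulo q^(N+1) as a commutative ring.

record EqMod (N : ℕ) (f g : Series) : Set where
  constructor mk
  field at : ∀ {n} → n ℕ.≤ N → f n ≡ g n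
open EqMod public

pointwise : ∀ {N f g} → f ≗ₛ g → EqMod N f g
pointwise e = mk λ {n} _ → e n

-- Opaque, so that ≈ between series is unified syntactically rather than coefficientwise.
opaque
  infixl 6 _＋_
  infixl 7 _·_
  infix  8 －_

  _＋_ _·_ : Series → Series → Series
  _＋_ = _⊕_
  _·_ = _⊗_

  －_ : Series → Series
  －_ = ⊝_

  ＋-def : ∀ f g → f ＋ g ≡ f ⊕ g
  ＋-def f g = refl

  ·-def : ∀ f g → f · g ≡ f ⊗ g
  ·-def f g = refl

  －-def : ∀ f → － f ≡ ⊝ f
  －-def f = refl

  isCommutativeRing : ∀ N → IsCommutativeRing (EqMod N) _＋_ _·_ －_ 𝟘 𝟙
  isCommutativeRing N = record
    { isRing = record
      { +-isAbelianGroup = record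
        { isGroup = record
          { isMonoid = record
            { isSemigroup = record
              { isMagma = record
                { isEquivalence = equiv
                ; ∙-cong = λ e e′ → mk λ n≤N → cong₂ ℤ._+_ (at e n≤N) (at e′ n≤N) }
              ; assoc = λ f g h → pointwise λ n → ℤ.+-assoc (f n) (g n) (h n) }
            ; identity = (λ f → pointwise λ n → ℤ.+-identityˡ (f n)) , (λ f → pointwise λ n → ℤ.+-identityʳ (f n)) }
          ; inverse = (λ f → pointwise λ n → ℤ.+-inverseˡ (f n)) , (λ f → pointwise λ n → ℤ.+-inverseʳ (f n))
          ; ⁻¹-cong = λ e → mk λ n≤N → cong ℤ.-_ (at e n≤N) }
        ; comm = λ f g → pointwise λ n → ℤ.+-comm (f n) (g n) }
      ; *-cong = λ e e′ → mk λ {n} n≤N → ⊗-cong-≤ n (λ m≤n → at e (ℕ.≤-trans m≤n n≤N)) (λ m≤n → at e′ (ℕ.≤-trans m≤n n≤N))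
      ; *-assoc = λ f g h → pointwise (⊗-assoc f g h)
      ; *-identity = (λ f → pointwise (𝟙⊗ f)) , (λ f → pointwise λ n → trans (⊗-comm f 𝟙 n) (𝟙⊗ f n))
      ; distrib = (λ f g h → pointwise λ n → trans (⊗-comm f (g ⊕ h) n)
                    (trans (⊗-distribʳ f g h n) (cong₂ ℤ._+_ (⊗-comm g f n) (⊗-comm h f n))))
                , (λ f g h → pointwise (⊗-distribʳ f g h)) }
    ; *-comm = λ f g → pointwise (⊗-comm f g) }
    where
    equiv : IsEquivalence (EqMod N)
    equiv = record
      { refl = mk λ _ → refl ; sym = λ e → mk λ n≤N → sym (at e n≤N)
      ; trans = λ e e′ → mk λ n≤N → trans (at e n≤N) (at e′ n≤N) }

truncatedRing : ℕ → CommutativeRing 0ℓ 0ℓ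
truncatedRing N = record { isCommutativeRing = isCommutativeRing N }

-- Monomials and finite sums of coefficients.

mono-suc : ∀ x k n → mono x (suc k) (suc n) ≡ mono x k n
-- The two decisions share only their boolean `does` by computation, so `⌊_⌋` is first converted to
-- it.
mono-suc x k n = cong (λ b → if b then x else 0ℤ)
  (trans (isYes≗does (suc k ℕ.≟ suc n)) (sym (isYes≗does (k ℕ.≟ n))))

mono-⊗-zero : ∀ x f → mono x 0 ⊗ f ≗ₛ λ n → x ℤ.* f n
mono-⊗-zero x f zero    = ⊗-zero (mono x 0) f
mono-⊗-zero x f (suc n) = trans (⊗-suc (mono x 0) f n)
  (trans (cong (ℤ._+_ (x ℤ.* f (suc n))) (𝟘⊗ f n)) (ℤ.+-identityʳ _))

mono-⊗-suc : ∀ x k f n → (mono x (suc k) ⊗ f) (suc n) ≡ (mono x k ⊗ f) n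
mono-⊗-suc x k f n = trans (⊗-suc (mono x (suc k)) f n)
  (trans (ℤ.+-identityˡ (((mono x (suc k) ∘ suc) ⊗ f) n)) (⊗-cong-≤ n {g = f} (λ {m} _ → mono-suc x k m) (λ _ → refl)))

mono-⊗-+ : ∀ k f n → (mono 1ℤ k ⊗ f) (k ℕ.+ n) ≡ f n
mono-⊗-+ zero    f n = trans (mono-⊗-zero 1ℤ f n) (ℤ.*-identityˡ (f n))
mono-⊗-+ (suc k) f n = trans (mono-⊗-suc 1ℤ k f (k ℕ.+ n)) (mono-⊗-+ k f n)

mono-⊗-< : ∀ x {k n} f → n ℕ.< k → (mono x k ⊗ f) n ≡ 0ℤ
mono-⊗-< x {suc k} {zero}  f n<k       = ⊗-zero (mono x (suc k)) f
mono-⊗-< x {suc k} {suc n} f (s≤s n<k) = trans (mono-⊗-suc x k f n) (mono-⊗-< x f n<k)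

mono-< : ∀ x {k n} → n ℕ.< k → mono x k n ≡ 0ℤ
mono-< x {suc k} {zero}  n<k       = refl
mono-< x {suc k} {suc n} (s≤s n<k) = trans (mono-suc x k n) (mono-< x n<k)

mono-⊗-mono : ∀ x y j k → mono x j ⊗ mono y k ≗ₛ mono (x ℤ.* y) (j ℕ.+ k)
mono-⊗-mono x y zero k n = trans (mono-⊗-zero x (mono y k) n) (scale k n)
  where
  scale : ∀ k n → x ℤ.* mono y k n ≡ mono (x ℤ.* y) k n
  scale zero    zero    = refl
  scale zero    (suc n) = ℤ.*-zeroʳ x
  scale (suc k) zero    = ℤ.*-zeroʳ x
  scale (suc k) (suc n) = trans (cong (x ℤ.*_) (mono-suc y k n)) (trans (scale k n) (sym (mono-suc (x ℤ.* y) k n)))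
mono-⊗-mono x y (suc j) k zero    = ⊗-zero (mono x (suc j)) (mono y k)
mono-⊗-mono x y (suc j) k (suc n) = trans (mono-⊗-suc x j (mono y k) n)
  (trans (mono-⊗-mono x y j k n) (sym (mono-suc (x ℤ.* y) (j ℕ.+ k) n)))

𝟙-mono : 𝟙 ≗ₛ mono 1ℤ 0
𝟙-mono zero    = refl
𝟙-mono (suc n) = refl

sumℤ-snoc : ∀ F n → sumℤ (applyUpTo F (suc n)) ≡ sumℤ (applyUpTo F n) ℤ.+ F n
sumℤ-snoc F zero    = trans (ℤ.+-identityʳ (F 0)) (sym (ℤ.+-identityˡ (F 0)))
sumℤ-snoc F (suc n) = trans (cong (ℤ._+_ (F 0)) (sumℤ-snoc (F ∘ suc) n)) (sym (ℤ.+-assoc (F 0) _ _))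

sumℤ-vanishing : ∀ F n d → (∀ {m} → n ℕ.≤ m → F m ≡ 0ℤ) →
                 sumℤ (applyUpTo F (d ℕ.+ n)) ≡ sumℤ (applyUpTo F n)
sumℤ-vanishing F n zero    e = refl
sumℤ-vanishing F n (suc d) e = trans (sumℤ-snoc F (d ℕ.+ n))
  (trans (cong₂ ℤ._+_ (sumℤ-vanishing F n d e) (e (ℕ.m≤n+m n d))) (ℤ.+-identityʳ _))

opaque
  μ : ℤ → ℕ → Series
  μ = mono

  μ-def : ∀ x k → μ x k ≡ mono x k
  μ-def x k = refl

-- Finite q-Pochhammer products.

prod : (ℕ → Series) → ℕ → Series
prod F zero    = 𝟙
prod F (suc n) = prod F n · F n

-- (x q^m ; q^s)_n
qPoch : ℤ → ℕ → ℕ → ℕ → Series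
qPoch x s m n = prod (λ i → 𝟙 ＋ － μ x (m ℕ.+ i ℕ.* s)) n

prodRange-≗ : ∀ {F G} n → (∀ i → F i ≗ₛ G i) → prodRange F n ≗ₛ prod G n
prodRange-≗         zero    e k = refl
prodRange-≗ {F} {G} (suc n) e k = trans
  (⊗-cong-≤ k {f = prodRange F n} {g = F n} (λ {j} _ → prodRange-≗ n e j) (λ {j} _ → e n j))
  (cong (λ h → h k) (sym (·-def (prod G n) (G n))))

pow-mono : ∀ s i → pow (mono 1ℤ s) i ≗ₛ mono 1ℤ (i ℕ.* s)
pow-mono s zero    k = 𝟙-mono k
pow-mono s (suc i) k = trans
  (⊗-cong-≤ k {f = mono 1ℤ s} {g = pow (mono 1ℤ s) i} (λ _ → refl) (λ {j} _ → pow-mono s i j))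
  (mono-⊗-mono 1ℤ 1ℤ s (i ℕ.* s) k)

poch-qPoch : ∀ x s m n → poch (mono x m) (mono 1ℤ s) n ≗ₛ qPoch x s m n
poch-qPoch x s m n = prodRange-≗ n λ i k → trans
  (cong (ℤ._-_ (𝟙 k)) (trans
    (⊗-cong-≤ k {f = mono x m} {g = pow (mono 1ℤ s) i} (λ _ → refl) (λ {j} _ → pow-mono s i j))
    (trans (mono-⊗-mono x 1ℤ m (i ℕ.* s) k)
      (trans (cong (λ y → mono y (m ℕ.+ i ℕ.* s) k) (ℤ.*-identityʳ x))
        (cong (λ h → h k) (sym (μ-def x (m ℕ.+ i ℕ.* s))))))))
  (trans (cong (λ h → 𝟙 k ℤ.+ h k) (sym (－-def (μ x (m ℕ.+ i ℕ.* s)))))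
    (cong (λ h → h k) (sym (＋-def 𝟙 (－ μ x (m ℕ.+ i ℕ.* s))))))

prodRange-constant : ∀ F n → (∀ i → F i 0 ≡ 1ℤ) → prodRange F n 0 ≡ 1ℤ
prodRange-constant F zero    e = refl
prodRange-constant F (suc n) e = trans (⊗-zero (prodRange F n) (F n)) (cong₂ ℤ._*_ (prodRange-constant F n e) (e n))

poch-constant : ∀ x m b n → poch (mono x (suc m)) b n 0 ≡ 1ℤ
poch-constant x m b n = prodRange-constant (λ i → 𝟙 ⊖ mono x (suc m) ⊗ pow b i) n
  λ i → cong (ℤ._-_ 1ℤ) (⊗-zero (mono x (suc m)) (pow b i))

qPoch-constant : ∀ x s m n → qPoch x s (suc m) n 0 ≡ 1ℤ
qPoch-constant x s m n = trans (sym (poch-qPoch x s (suc m) n 0)) (poch-constant x m (mono 1ℤ s) n)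

-- Infinite products modulo q^(N+1) and the concrete coefficients α and β.

module Truncated (N : ℕ) where

  open CommutativeRing (truncatedRing N)
    using (_≈_; setoid; commutativeSemiring; +-cong; +-congˡ; +-congʳ; *-cong; *-congˡ; *-congʳ; *-assoc; *-comm;
           *-identityˡ; *-identityʳ; +-identityʳ; +-assoc; zeroˡ; -‿cong; -‿inverseˡ; distribʳ)
    renaming (refl to ≈-refl; sym to ≈-sym; trans to ≈-trans; reflexive to ≈-reflexive)
  open SetoidReasoning setoid
  open SemiringSolver commutativeSemiring using (solve; _:=_; _:+_; _:*_)

  opaque
    unfolding μ _·_ _＋_ －_

    μ-far : ∀ x {k} → N ℕ.< k → μ x k ≈ 𝟘
    μ-far x N<k = mk λ n≤N → mono-< x (ℕ.≤-<-trans n≤N N<k)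

    μ-+ : ∀ x j k → μ x (j ℕ.+ k) ≈ μ x j · μ 1ℤ k
    μ-+ x j k = ≈-trans (≈-reflexive (cong (λ y → mono y (j ℕ.+ k)) (sym (ℤ.*-identityʳ x))))
      (≈-sym (pointwise (mono-⊗-mono x 1ℤ j k)))

    𝟙-μ : 𝟙 ≈ μ 1ℤ 0
    𝟙-μ = pointwise 𝟙-mono

    －𝟘 : 𝟙 ＋ － 𝟘 ≈ 𝟙
    －𝟘 = pointwise λ n → ℤ.+-identityʳ (𝟙 n)

    －μ : ∀ m → － μ -1ℤ m ≈ μ 1ℤ m
    －μ m = pointwise (negate m)
      where
      negate : ∀ m n → ℤ.- mono -1ℤ m n ≡ mono 1ℤ m n
      negate zero    zero    = refl
      negate zero    (suc n) = refl
      negate (suc m) zero    = refl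
      negate (suc m) (suc n) = trans (cong ℤ.-_ (mono-suc -1ℤ m n)) (trans (negate m n) (sym (mono-suc 1ℤ m n)))

    μ-2 : ∀ k → μ (+ 2) k ≈ μ 1ℤ k ＋ μ 1ℤ k
    μ-2 k = pointwise (double k)
      where
      double : ∀ k n → mono (+ 2) k n ≡ mono 1ℤ k n ℤ.+ mono 1ℤ k n
      double zero    zero    = refl
      double zero    (suc n) = refl
      double (suc k) zero    = refl
      double (suc k) (suc n) = trans (mono-suc (+ 2) k n) (trans (double k n) (sym (cong₂ ℤ._+_ (mono-suc 1ℤ k n) (mono-suc 1ℤ k n))))

    inverseʳ : ∀ f → f 0 ≡ 1ℤ → f · inv f ≈ 𝟙
    inverseʳ f f₀ = pointwise (⊗-inverseʳ f f₀)

  μ-≡ : ∀ x {j k} → j ≡ k → μ x j ≈ μ x k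
  μ-≡ x e = ≈-reflexive (cong (μ x) e)

  factor-far : ∀ x {m} → N ℕ.< m → 𝟙 ＋ － μ x m ≈ 𝟙
  factor-far x N<m = ≈-trans (+-congˡ (-‿cong (μ-far x N<m))) －𝟘

  prod-cong : ∀ {F G} n → (∀ i → F i ≈ G i) → prod F n ≈ prod G n
  prod-cong zero    e = ≈-refl
  prod-cong (suc n) e = *-cong (prod-cong n e) (e n)

  prod-head : ∀ F n → prod F (suc n) ≈ F 0 · prod (F ∘ suc) n
  prod-head F zero    = *-comm 𝟙 (F 0)
  prod-head F (suc n) = ≈-trans (*-congʳ (prod-head F n)) (*-assoc (F 0) _ _)

  prod-𝟙 : ∀ {F} n → (∀ i → F i ≈ 𝟙) → prod F n ≈ 𝟙
  prod-𝟙 zero    e = ≈-refl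
  prod-𝟙 (suc n) e = ≈-trans (*-cong (prod-𝟙 n e) (e n)) (*-identityˡ 𝟙)

  -- Modulo q^(N+1), the product of N + 1 factors stands for the infinite one: the next factor has
  -- exponent beyond N and equals 1. It is appended, and then the first factor is split off.
  qPoch-step : ∀ x s m → qPoch x (suc s) m (suc N) ≈ (𝟙 ＋ － μ x m) · qPoch x (suc s) (suc s ℕ.+ m) (suc N)
  qPoch-step x s m = begin
    qPoch x (suc s) m (suc N)
      ≈⟨ *-identityʳ _ ⟨
    qPoch x (suc s) m (suc N) · 𝟙
      ≈⟨ *-congˡ (factor-far x far) ⟨
    qPoch x (suc s) m (suc (suc N))
      ≈⟨ prod-head _ (suc N) ⟩
    (𝟙 ＋ － μ x (m ℕ.+ 0)) · prod (λ i → 𝟙 ＋ － μ x (m ℕ.+ suc i ℕ.* suc s)) (suc N)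
      ≈⟨ *-cong (+-congˡ (-‿cong (μ-≡ x (ℕ.+-identityʳ m)))) (prod-cong (suc N) λ i →
           +-congˡ (-‿cong (μ-≡ x (exponent s m i)))) ⟩
    (𝟙 ＋ － μ x m) · qPoch x (suc s) (suc s ℕ.+ m) (suc N) ∎
    where
    exponent : ∀ s m i → m ℕ.+ suc i ℕ.* suc s ≡ suc s ℕ.+ m ℕ.+ i ℕ.* suc s
    exponent = solve-∀
    far : N ℕ.< m ℕ.+ suc N ℕ.* suc s
    far = ℕ.≤-trans (ℕ.m≤m*n (suc N) (suc s)) (ℕ.m≤n+m _ m)

  qPoch-far : ∀ x s {m} n → N ℕ.< m → qPoch x s m n ≈ 𝟙
  qPoch-far x s {m} n N<m = prod-𝟙 n λ i → factor-far x (ℕ.≤-trans N<m (ℕ.m≤m+n m _))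

  qPoch-split : ∀ x s m n → qPoch x (suc s) m (suc N) ≈ qPoch x (suc s) m n · qPoch x (suc s) (n ℕ.* suc s ℕ.+ m) (suc N)
  qPoch-split x s m zero    = ≈-sym (*-identityˡ _)
  qPoch-split x s m (suc n) = begin
    qPoch x (suc s) m (suc N)
      ≈⟨ qPoch-split x s m n ⟩
    p · qPoch x (suc s) (n ℕ.* suc s ℕ.+ m) (suc N)
      ≈⟨ *-congˡ (qPoch-step x s (n ℕ.* suc s ℕ.+ m)) ⟩
    p · ((𝟙 ＋ － μ x (n ℕ.* suc s ℕ.+ m)) · qPoch x (suc s) (suc s ℕ.+ (n ℕ.* suc s ℕ.+ m)) (suc N))
      ≈⟨ *-assoc _ _ _ ⟨
    p · (𝟙 ＋ － μ x (n ℕ.* suc s ℕ.+ m)) · qPoch x (suc s) (suc s ℕ.+ (n ℕ.* suc s ℕ.+ m)) (suc N)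
      ≈⟨ *-cong (*-congˡ (+-congˡ (-‿cong (μ-≡ x (ℕ.+-comm (n ℕ.* suc s) m)))))
           (≈-reflexive (cong (λ j → qPoch x (suc s) j (suc N)) (sym (ℕ.+-assoc (suc s) (n ℕ.* suc s) m)))) ⟩
    qPoch x (suc s) m (suc n) · qPoch x (suc s) (suc n ℕ.* suc s ℕ.+ m) (suc N) ∎
    where p = qPoch x (suc s) m n

  inv-unique : ∀ f {g} → f 0 ≡ 1ℤ → f · g ≈ 𝟙 → g ≈ inv f
  inv-unique f {g} f₀ e = begin
    g               ≈⟨ *-identityʳ g ⟨
    g · 𝟙           ≈⟨ *-congˡ (inverseʳ f f₀) ⟨
    g · (f · inv f) ≈⟨ solve 3 (λ g f i → g :* (f :* i) := (f :* g) :* i) ≈-refl g f (inv f) ⟩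
    (f · g) · inv f ≈⟨ *-congʳ e ⟩
    𝟙 · inv f       ≈⟨ *-identityˡ (inv f) ⟩
    inv f           ∎

  -- Cancels a common factor u from a quotient: by uniqueness of inverses it suffices to multiply by
  -- e′.
  inv-quotient : ∀ e e′ u → e 0 ≡ 1ℤ → e′ 0 ≡ 1ℤ → e ≈ u · e′ → u · inv e ≈ inv e′
  inv-quotient e e′ u e₀ e′₀ eq = inv-unique e′ e′₀ (begin
    e′ · (u · inv e) ≈⟨ solve 3 (λ e u i → e :* (u :* i) := (u :* e) :* i) ≈-refl e′ u (inv e) ⟩
    (u · e′) · inv e ≈⟨ *-congʳ eq ⟨
    e · inv e        ≈⟨ inverseʳ e e₀ ⟩
    𝟙                ∎)

  inv-cong : ∀ e e′ → e 0 ≡ 1ℤ → e′ 0 ≡ 1ℤ → e ≈ e′ → inv e ≈ inv e′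
  inv-cong e e′ e₀ e′₀ eq = ≈-trans (≈-sym (*-identityˡ (inv e)))
    (inv-quotient e e′ 𝟙 e₀ e′₀ (≈-trans eq (≈-sym (*-identityˡ e′))))

  -- Turns (1 - f) g = h into the subtraction-free form that the functional equations take as
  -- hypothesis.
  move-factor : ∀ f g h → (𝟙 ＋ － f) · g ≈ h → g ≈ h ＋ f · g
  move-factor f g h e = begin
    g                         ≈⟨ *-identityˡ g ⟨
    𝟙 · g                     ≈⟨ *-congʳ (+-identityʳ 𝟙) ⟨
    (𝟙 ＋ 𝟘) · g              ≈⟨ *-congʳ (+-congˡ (-‿inverseˡ f)) ⟨
    (𝟙 ＋ (－ f ＋ f)) · g    ≈⟨ *-congʳ (+-assoc 𝟙 (－ f) f) ⟨
    ((𝟙 ＋ － f) ＋ f) · g    ≈⟨ distribʳ g (𝟙 ＋ － f) f ⟩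
    (𝟙 ＋ － f) · g ＋ f · g  ≈⟨ +-congʳ e ⟩
    h ＋ f · g                ∎

  plus-factor : ∀ m f → (𝟙 ＋ － μ -1ℤ m) · f ≈ f ＋ μ 1ℤ m · f
  plus-factor m f = begin
    (𝟙 ＋ － μ -1ℤ m) · f ≈⟨ *-congʳ (+-congˡ (－μ m)) ⟩
    (𝟙 ＋ μ 1ℤ m) · f     ≈⟨ distribʳ f 𝟙 (μ 1ℤ m) ⟩
    𝟙 · f ＋ μ 1ℤ m · f   ≈⟨ +-congʳ (*-identityˡ f) ⟩
    f ＋ μ 1ℤ m · f       ∎

  -- Here `E j` = (q^(j+1);q)_∞, `pos n` = (-q²;q²)_n and `neg n` = 1/(q²;q²)_n. Thus α_n is the
  -- n-th summand of the theorem multiplied by (-q;q²)_n, and β_n = q^(n(n+1)) (-q²;q²)_n /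
  -- (q²;q²)_n.
  x D E J pos neg α β : ℕ → Series
  x = μ 1ℤ
  D j = qPoch -1ℤ 2 j (suc N)
  E j = qPoch 1ℤ 1 (suc j) (suc N)
  J j = inv (E j)
  pos n = qPoch -1ℤ 2 2 n
  neg n = inv (qPoch 1ℤ 2 2 n)
  β n = μ 1ℤ (n ℕ.* suc n) · pos n · neg n
  α zero    = 𝟙
  α (suc n) = μ (+ 2) (suc n ℕ.* suc (suc n)) · pos n · neg (suc n)

  E-constant : ∀ j → E j 0 ≡ 1ℤ
  E-constant j = qPoch-constant 1ℤ 1 j (suc N)

  J-step : ∀ j → J j ≈ J (suc j) ＋ x (suc j) · J j
  J-step j = move-factor (x (suc j)) (J j) (J (suc j))
    (inv-quotient (E j) (E (suc j)) _ (E-constant j) (E-constant (suc j)) (qPoch-step 1ℤ 0 (suc j)))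

  J-far : ∀ {j} → N ℕ.< j → J j ≈ 𝟙
  J-far {j} N<j = ≈-sym (inv-unique (E j) (E-constant j)
    (≈-trans (*-identityʳ _) (qPoch-far 1ℤ 1 (suc N) (ℕ.m≤n⇒m≤1+n N<j))))

  D-step : ∀ j → D j ≈ D (2 ℕ.+ j) ＋ x j · D (2 ℕ.+ j)
  D-step j = ≈-trans (qPoch-step -1ℤ 1 j) (plus-factor j _)

  factor-2 : ∀ y n → 𝟙 ＋ － μ y (2 ℕ.+ n ℕ.* 2) ≈ 𝟙 ＋ － μ y (2 ℕ.* suc n)
  factor-2 y n = +-congˡ (-‿cong (μ-≡ y (exponent n)))
    where
    exponent : ∀ n → 2 ℕ.+ n ℕ.* 2 ≡ 2 ℕ.* suc n
    exponent = solve-∀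

  pos-suc : ∀ n → pos (suc n) ≈ pos n ＋ x (2 ℕ.* suc n) · pos n
  pos-suc n = ≈-trans (≈-trans (*-congˡ (factor-2 -1ℤ n)) (*-comm (pos n) _)) (plus-factor (2 ℕ.* suc n) (pos n))

  neg-suc : ∀ n → neg (suc n) ≈ neg n ＋ x (2 ℕ.* suc n) · neg (suc n)
  neg-suc n = move-factor (x (2 ℕ.* suc n)) (neg (suc n)) (neg n)
    (inv-quotient (qPoch 1ℤ 2 2 (suc n)) (qPoch 1ℤ 2 2 n) _ (qPoch-constant 1ℤ 2 1 (suc n)) (qPoch-constant 1ℤ 2 1 n)
      (≈-trans (*-congˡ (factor-2 1ℤ n)) (*-comm (qPoch 1ℤ 2 2 n) _)))

  exponent-suc : ∀ n → suc n ℕ.* suc (suc n) ≡ n ℕ.* suc n ℕ.+ 2 ℕ.* suc n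
  exponent-suc = solve-∀

  α-expand : ∀ n → α (suc n) ≈ (x (n ℕ.* suc n) · x (2 ℕ.* suc n) ＋ x (n ℕ.* suc n) · x (2 ℕ.* suc n)) · pos n · neg (suc n)
  α-expand n = *-congʳ (*-congʳ (≈-trans (μ-≡ (+ 2) (exponent-suc n)) (≈-trans (μ-2 (n ℕ.* suc n ℕ.+ 2 ℕ.* suc n)) (+-cong split split))))
    where
    split = μ-+ 1ℤ (n ℕ.* suc n) (2 ℕ.* suc n)

  -- The factor w = q^(2(n+1)) comes from (n+1)(n+2) = n(n+1) + 2(n+1); expanding 1/(q²;q²)_(n+1) by
  -- `neg-suc` then produces 2 β_n and α_(n+1) again.
  α-suc : ∀ n → α (suc n) ≈ x (2 ℕ.* suc n) · (α (suc n) ＋ (β n ＋ β n))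
  α-suc n = begin
    α (suc n)
      ≈⟨ α-expand n ⟩
    (m · w ＋ m · w) · p · neg (suc n)
      ≈⟨ *-congˡ (neg-suc n) ⟩
    (m · w ＋ m · w) · p · (neg n ＋ w · neg (suc n))
      ≈⟨ solve 5 (λ m w p i i′ → (m :* w :+ m :* w) :* p :* (i :+ w :* i′) :=
           w :* ((m :* w :+ m :* w) :* p :* i′ :+ (m :* p :* i :+ m :* p :* i))) ≈-refl m w p (neg n) (neg (suc n)) ⟩
    w · ((m · w ＋ m · w) · p · neg (suc n) ＋ (β n ＋ β n))
      ≈⟨ *-congˡ (+-congʳ (α-expand n)) ⟨
    w · (α (suc n) ＋ (β n ＋ β n)) ∎
    where
    m w p : Series
    m = x (n ℕ.* suc n)
    w = x (2 ℕ.* suc n)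
    p = pos n

  -- With i and i′ for `neg n` and `neg (suc n)`, the last factor 1 + w of `pos (suc n)` gives (1 +
  -- w) i′ = i + 2 w i′; the two parts become β_n and α_(n+1).
  β-suc : ∀ n → β (suc n) ≈ x (2 ℕ.* suc n) · (α (suc n) ＋ β n)
  β-suc n = begin
    β (suc n)
      ≈⟨ *-congʳ (*-cong (≈-trans (μ-≡ 1ℤ (exponent-suc n)) (μ-+ 1ℤ (n ℕ.* suc n) (2 ℕ.* suc n))) (pos-suc n)) ⟩
    (m · w) · (p ＋ w · p) · neg (suc n)
      ≈⟨ solve 4 (λ m w p i′ → (m :* w) :* (p :+ w :* p) :* i′ := (m :* w) :* p :* i′ :+ (m :* w) :* p :* (w :* i′)) ≈-refl m w p (neg (suc n)) ⟩
    (m · w) · p · neg (suc n) ＋ (m · w) · p · (w · neg (suc n))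
      ≈⟨ +-congʳ (*-congˡ (neg-suc n)) ⟩
    (m · w) · p · (neg n ＋ w · neg (suc n)) ＋ (m · w) · p · (w · neg (suc n))
      ≈⟨ solve 5 (λ m w p i i′ → (m :* w) :* p :* (i :+ w :* i′) :+ (m :* w) :* p :* (w :* i′) :=
           w :* ((m :* w :+ m :* w) :* p :* i′ :+ m :* p :* i)) ≈-refl m w p (neg n) (neg (suc n)) ⟩
    w · ((m · w ＋ m · w) · p · neg (suc n) ＋ β n)
      ≈⟨ *-congˡ (+-congʳ (α-expand n)) ⟨
    w · (α (suc n) ＋ β n) ∎
    where
    m w p : Series
    m = x (n ℕ.* suc n)
    w = x (2 ℕ.* suc n)
    p = pos n

  β-0 : β 0 ≈ 𝟙
  β-0 = ≈-trans (*-congʳ (*-identityʳ _)) (≈-trans (*-cong (≈-sym 𝟙-μ) inv-𝟙) (*-identityˡ _))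
    where
    inv-𝟙 : inv 𝟙 ≈ 𝟙
    inv-𝟙 = ≈-sym (inv-unique 𝟙 refl (*-identityˡ 𝟙))

  open FunctionalEquations (truncatedRing N) N x D J α β
    (≈-sym 𝟙-μ) (μ-+ 1ℤ) (μ-far 1ℤ) D-step (qPoch-far -1ℤ 2 (suc N)) J-step J-far
    ≈-refl β-0 α-suc β-suc public


  -- The right-hand side as A(0)/(q;q)_∞.

  qPoch-stable : ∀ y s m d → qPoch y (suc s) (suc m) (d ℕ.+ suc N) ≈ qPoch y (suc s) (suc m) (suc N)
  qPoch-stable y s m zero    = ≈-refl
  qPoch-stable y s m (suc d) = ≈-trans (*-cong (qPoch-stable y s m d) (factor-far y far)) (*-identityʳ _)
    where
    far : N ℕ.< suc m ℕ.+ (d ℕ.+ suc N) ℕ.* suc s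
    far = ℕ.≤-trans (ℕ.m≤n+m (suc N) d) (ℕ.≤-trans (ℕ.m≤m*n (d ℕ.+ suc N) (suc s)) (ℕ.m≤n+m _ (suc m)))

  denominator : ℕ → Series
  denominator n = poch q² q² n ⊗ poch -q q² n

  denominator-constant : ∀ n → denominator n 0 ≡ 1ℤ
  denominator-constant n = trans (⊗-zero (poch q² q² n) (poch -q q² n))
    (cong₂ ℤ._*_ (poch-constant 1ℤ 1 q² n) (poch-constant -1ℤ 0 q² n))

  ⊗-· : ∀ {f f′ g g′} → f ≈ f′ → g ≈ g′ → f ⊗ g ≈ f′ · g′
  ⊗-· {f} {f′} {g} e e′ = ≈-trans (≈-reflexive (sym (·-def f g))) (*-cong e e′)

  denominator-qPoch : ∀ n → denominator n ≈ qPoch -1ℤ 2 1 n · qPoch 1ℤ 2 2 n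
  denominator-qPoch n = ≈-trans (⊗-· {poch q² q² n} {qPoch 1ℤ 2 2 n} {poch -q q² n} {qPoch -1ℤ 2 1 n} (pointwise (poch-qPoch 1ℤ 2 2 n)) (pointwise (poch-qPoch -1ℤ 2 1 n))) (*-comm (qPoch 1ℤ 2 2 n) (qPoch -1ℤ 2 1 n))

  summand-≈ : ∀ n → summand (suc n) ≈ μ (+ 2) (suc n ℕ.* suc (suc n)) · pos n · inv (denominator (suc n))
  summand-≈ n = ⊗-· {mono (+ 2) (suc n ℕ.* suc (suc n)) ⊗ poch -q² q² n} {_} {inv (denominator (suc n))}
    (⊗-· {mono (+ 2) (suc n ℕ.* suc (suc n))} {_} {poch -q² q² n} (≈-reflexive (sym (μ-def (+ 2) _))) (pointwise (poch-qPoch -1ℤ 2 2 n))) ≈-refl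

  summand-far : ∀ {n} → N ℕ.≤ n → summand (suc n) ≈ 𝟘
  summand-far {n} N≤n = ≈-trans (summand-≈ n) (≈-trans (*-congʳ (≈-trans (*-congʳ (μ-far (+ 2) far)) (zeroˡ _))) (zeroˡ _))
    where
    far : N ℕ.< suc n ℕ.* suc (suc n)
    far = ℕ.≤-trans (s≤s N≤n) (ℕ.m≤m*n (suc n) (suc (suc n)))

  term : ℕ → Series
  term zero    = 𝟙
  term (suc n) = summand (suc n)

  -- In (-q;q²)_∞ = (-q;q²)_n (-q^(2n+1);q²)_∞ the finite factor cancels against the denominator of
  -- the n-th summand, which leaves α_n times the remaining infinite product.
  D-1·term : ∀ n → D 1 · term n ≈ a-term 0 n
  D-1·term zero    = ≈-trans (*-comm (D 1) 𝟙) (*-congˡ (≈-trans (≈-sym (*-identityˡ (D 1))) (*-congʳ 𝟙-μ)))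
  D-1·term (suc n) = begin
    D 1 · summand (suc n)
      ≈⟨ *-cong (qPoch-split -1ℤ 1 1 (suc n)) (summand-≈ n) ⟩
    (u · D (suc n ℕ.* 2 ℕ.+ 1)) · (a · pos n · i)
      ≈⟨ solve 5 (λ u d a p i → (u :* d) :* (a :* p :* i) := a :* p :* (u :* i) :* d) ≈-refl u (D (suc n ℕ.* 2 ℕ.+ 1)) a (pos n) i ⟩
    (a · pos n · (u · i)) · D (suc n ℕ.* 2 ℕ.+ 1)
      ≈⟨ *-cong (*-congˡ (inv-quotient (denominator (suc n)) (qPoch 1ℤ 2 2 (suc n)) u (denominator-constant (suc n)) (qPoch-constant 1ℤ 2 1 (suc n)) (denominator-qPoch (suc n))))
           (≈-reflexive (cong D (cong (ℕ._+ 1) (ℕ.*-comm (suc n) 2)))) ⟩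
    α (suc n) · D (2 ℕ.* suc n ℕ.+ 1)
      ≈⟨ *-congˡ (≈-trans (≈-sym (*-identityˡ (D (2 ℕ.* suc n ℕ.+ 1)))) (*-congʳ 𝟙-μ)) ⟩
    a-term 0 (suc n) ∎
    where
    u a i : Series
    u = qPoch -1ℤ 2 1 (suc n)
    a = μ (+ 2) (suc n ℕ.* suc (suc n))
    i = inv (denominator (suc n))

  ∑-coefficient : ∀ k n → ∑ (suc k) term n ≡ 𝟙 n ℤ.+ sumℤ (applyUpTo (λ m → summand (suc m) n) k)
  ∑-coefficient zero n = trans (cong (λ h → h n) (＋-def 𝟘 𝟙)) (ℤ.+-comm 0ℤ (𝟙 n))
  ∑-coefficient (suc k) n = trans (cong (λ h → h n) (＋-def (∑ (suc k) term) (summand (suc k))))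
    (trans (cong (ℤ._+ summand (suc k) n) (∑-coefficient k n))
    (trans (ℤ.+-assoc (𝟙 n) _ (summand (suc k) n))
      (cong (ℤ._+_ (𝟙 n)) (sym (sumℤ-snoc (λ m → summand (suc m) n) k)))))

-- Coefficient n of `pochInf` uses only n + 1 factors; stability modulo q^(n+1) extends the product
-- to N + 1 factors, the same number for every n ≤ N.
pochInf-qPoch : ∀ N y s m → EqMod N (pochInf (mono y (suc m)) (mono 1ℤ (suc s))) (qPoch y (suc s) (suc m) (suc N))
pochInf-qPoch N y s m = mk λ {n} n≤N → trans (poch-qPoch y (suc s) (suc m) (suc n) n)
  (trans (sym (at (Truncated.qPoch-stable n y s m (N ∸ n)) ℕ.≤-refl))
    (cong (λ j → qPoch y (suc s) (suc m) j n) (trans (ℕ.+-suc (N ∸ n) n) (cong suc (ℕ.m∸n+n≡m n≤N)))))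

pochInf-constant : ∀ y m b → pochInf (mono y (suc m)) b 0 ≡ 1ℤ
pochInf-constant y m b = poch-constant y m b 1

module _ (N : ℕ) where
  open Truncated N
  open CommutativeRing (truncatedRing N)
    using (_≈_; setoid; *-congˡ; *-congʳ; *-comm) renaming (refl to ≈-refl; sym to ≈-sym; trans to ≈-trans)

  -- Coefficient n of `bracket` stops at the n-th summand. The summands up to N can be added because
  -- they vanish modulo q^(n+1), hence `summand-far` at level n.
  bracket-∑ : bracket ≈ ∑ (suc N) term
  bracket-∑ = mk λ {n} n≤N → trans
    (cong (λ xs → 𝟙 n ℤ.+ sumℤ xs) (List.map-upTo (λ m → summand (suc m) n) n))
    (trans (cong (ℤ._+_ (𝟙 n)) (sym (sumℤ-vanishing (λ m → summand (suc m) n) n (N ∸ n)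
             λ n≤m → at (Truncated.summand-far n n≤m) ℕ.≤-refl)))
    (trans (cong (λ j → 𝟙 n ℤ.+ sumℤ (applyUpTo (λ m → summand (suc m) n) j)) (ℕ.m∸n+n≡m n≤N))
      (sym (∑-coefficient N n))))

  rhs-≈ : rhs ≈ A 0 · J 0
  rhs-≈ = ⊗-· {bracket ⊗ pochInf -q q²} {A 0} {inv (pochInf q q)} {J 0}
    (≈-trans (⊗-· {bracket} {_} {pochInf -q q²} bracket-∑ (pochInf-qPoch N -1ℤ 1 0))
      (≈-trans (*-comm (∑ (suc N) term) (D 1)) (≈-trans (∑-distribˡ (suc N) (D 1) term) (∑-cong (suc N) D-1·term))))
    (inv-cong (pochInf q q) (E 0) (pochInf-constant 1ℤ 0 q) (E-constant 0) (pochInf-qPoch N 1ℤ 0 0))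

-- Finite enumerations and their cardinalities.

Enum : {A : Set} → (A → Set) → ℤ → Set
Enum {A} P z = Σ (List A) λ xs → Unique xs × All P xs × (∀ a → P a → a ∈ xs) × + length xs ≡ z

module _ {A : Set} where

  enum-≡ : ∀ {P : A → Set} {y z} → y ≡ z → Enum P y → Enum P z
  enum-≡ refl e = e

  same-length : ∀ {xs ys : List A} → Unique xs → Unique ys →
                (∀ {a} → a ∈ xs → a ∈ ys) → (∀ {a} → a ∈ ys → a ∈ xs) → length xs ≡ length ys
  same-length u v to from = ↭-length (∼bag⇒↭ (unique∧set⇒bag u v (mk⇔ to from)))

  enum-⊎ : ∀ {P Q R : A → Set} {y z} → Enum P y → Enum Q z → (∀ {a} → P a → ¬ Q a) →
           (∀ {a} → P a → R a) → (∀ {a} → Q a → R a) → (∀ {a} → R a → P a ⊎ Q a) → Enum R (y ℤ.+ z)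
  enum-⊎ (xs , u , p , c , refl) (ys , v , q , d , refl) disjoint inP inQ split =
    xs ++ ys
    , Unique.++⁺ u v (λ (m , m′) → disjoint (All.lookup p m) (All.lookup q m′))
    , All.++⁺ (All.map inP p) (All.map inQ q)
    , (λ a r → [ ∈-++⁺ˡ ∘ c a , ∈-++⁺ʳ xs ∘ d a ]′ (split r))
    , cong +_ (List.length-++ xs)

  -- Integer cardinalities make the subtraction honest. The count holds because `xs` and `ys ++ zs`
  -- are duplicate-free with the same members.
  enum-∖ : ∀ {P Q : A → Set} {y z} → Decidable P → Enum Q y → Enum (λ a → P a × Q a) z →
           Enum (λ a → ¬ P a × Q a) (y ℤ.- z)
  enum-∖ {P} {Q} P? (xs , u , q , c , refl) (ys , v , pq , d , refl) =
    zs , Unique.filter⁺ (¬? ∘ P?) u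
    , All.tabulate (λ m → let m′ , ¬p = ∈-filter⁻ (¬? ∘ P?) m in ¬p , All.lookup q m′)
    , (λ a (¬p , qa) → ∈-filter⁺ (¬? ∘ P?) (c a qa) ¬p)
    , trans (cancel (+ length zs) (+ length ys)) (cong (ℤ._- + length ys) (sym (cong +_ (trans lengths (List.length-++ ys)))))
    where
    zs = filter (¬? ∘ P?) xs
    cancel : ∀ m n → m ≡ n ℤ.+ m ℤ.- n
    cancel = ℤSolver.solve-∀
    to : ∀ {a} → a ∈ xs → a ∈ ys ++ zs
    to {a} m with P? a
    ... | yes p = ∈-++⁺ˡ (d a (p , All.lookup q m))
    ... | no ¬p = ∈-++⁺ʳ ys (∈-filter⁺ (¬? ∘ P?) m ¬p)
    from : ∀ {a} → a ∈ ys ++ zs → a ∈ xs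
    from {a} m with ∈-++⁻ ys m
    ... | inj₁ m′ = c a (proj₂ (All.lookup pq m′))
    ... | inj₂ m′ = proj₁ (∈-filter⁻ (¬? ∘ P?) m′)
    lengths : length xs ≡ length (ys ++ zs)
    lengths = same-length u
      (Unique.++⁺ v (Unique.filter⁺ (¬? ∘ P?) u)
        (λ (m , m′) → proj₂ (∈-filter⁻ (¬? ∘ P?) {xs = xs} m′) (proj₁ (All.lookup pq m)))) to from

-- The inverse laws are asked for only on `P` and `Q`: removing and restoring a part, for example,
-- are inverse only under bounds on the parts.
module _ {A B : Set} {P : A → Set} {Q : B → Set} (f : A → B) (g : B → A)
  (to : ∀ {a} → P a → Q (f a)) (from : ∀ {b} → Q b → P (g b))
  (gf : ∀ {a} → P a → g (f a) ≡ a) (fg : ∀ {b} → Q b → f (g b) ≡ b) where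

  private
    unique-map : ∀ {xs} → All P xs → Unique xs → Unique (map f xs)
    unique-map []       []      = []
    unique-map (p ∷ ps) (n ∷ u) =
      All.map⁺ (All.zipWith (λ (x≢y , py) e → x≢y (trans (sym (gf p)) (trans (cong g e) (gf py)))) (n , ps)) ∷ unique-map ps u

  enum-map : ∀ {z} → Enum P z → Enum Q z
  enum-map (xs , u , p , c , e) =
    map f xs , unique-map p u , All.map⁺ (All.map to p)
    , (λ b q → subst (_∈ map f xs) (fg q) (∈-map⁺ f (c (g b) (from q))))
    , trans (cong +_ (List.length-map f xs)) e

enum-⇔ : ∀ {A : Set} {P Q : A → Set} {z} → (∀ {a} → P a → Q a) → (∀ {a} → Q a → P a) → Enum P z → Enum Q z
enum-⇔ to from = enum-map (λ a → a) (λ a → a) to from (λ _ → refl) (λ _ → refl)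

enum-∪ : ∀ {A : Set} {U R S : A → Set} {x y z} → Decidable R →
         Enum (U ∩ R) x → Enum (U ∩ S) y → Enum (U ∩ (R ∩ S)) z → Enum (U ∩ (R ∪ S)) (x ℤ.+ (y ℤ.- z))
enum-∪ {U = U} {R} {S} R? r s rs =
  enum-⊎ r (enum-∖ R? s (enum-⇔ (λ (u , r , s) → r , u , s) (λ (r , u , s) → u , r , s) rs))
    (λ (_ , r) (¬r , _) → ¬r r)
    (λ (u , r) → u , inj₁ r) (λ (_ , u , s) → u , inj₂ s) split
  where
  split : ∀ {a} → U a × (R a ⊎ S a) → (U a × R a) ⊎ (¬ R a × U a × S a)
  split     (u , inj₁ r) = inj₁ (u , r)
  split {a} (u , inj₂ s) with R? a
  ... | yes r = inj₁ (u , r)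
  ... | no ¬r = inj₂ (¬r , u , s)

Always : ∀ {A : Set} → A → Set
Always _ = ⊤

enum-always : ∀ {A : Set} {P : A → Set} {z} → Enum P z → Enum (P ∩ Always) z
enum-always = enum-⇔ (_, tt) proj₁

-- Removing the largest part of a row, and interlacing.

Rows : ℕ → Set
Rows = Vec (List ℕ)

top : List ℕ → ℕ
top xs = part xs 0

-- A zero part is never stored, so M = 0 adds nothing; on the only partition with parts at most 0,
-- the empty one, `pop` still undoes this.
push : ℕ → List ℕ → List ℕ
push zero    xs = xs
push (suc m) xs = suc m ∷ xs

pop : List ℕ → List ℕ
pop []       = []
pop (_ ∷ xs) = xs

part-pop : ∀ xs j → part (pop xs) j ≡ part xs (suc j)
part-pop []       j = refl
part-pop (_ ∷ xs) j = refl

sum-pop : ∀ xs → ℕ.sum xs ≡ top xs + ℕ.sum (pop xs)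
sum-pop []       = refl
sum-pop (_ ∷ xs) = refl

top-pop : ∀ {xs} → IsPartition xs → top (pop xs) ≤ top xs
top-pop {[]}         p                     = z≤n
top-pop {x ∷ []}     p                     = z≤n
top-pop {x ∷ y ∷ xs} (_ , (y≤x ∷ _))       = y≤x

pop-partition : ∀ {xs} → IsPartition xs → IsPartition (pop xs)
pop-partition {[]}         p                     = p
pop-partition {x ∷ []}     p                     = [] , []
pop-partition {x ∷ y ∷ xs} ((_ ∷ pos) , (_ ∷ l)) = pos , l

part≤top : ∀ {xs} → IsPartition xs → ∀ j → part xs j ≤ top xs
part≤top {xs} p zero    = ℕ.≤-refl
part≤top {xs} p (suc j) = subst (_≤ top xs) (part-pop xs j) (ℕ.≤-trans (part≤top (pop-partition p) j) (top-pop p))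

top≤0 : ∀ {xs} → IsPartition xs → top xs ≤ 0 → xs ≡ []
top≤0 {[]}         p             t  = refl
top≤0 {suc x ∷ xs} p             ()
top≤0 {zero ∷ xs}  ((() ∷ _) , _) t

push-partition : ∀ M {xs} → IsPartition xs → top xs ≤ M → IsPartition (push M xs)
push-partition zero             p         t = p
push-partition (suc m) {[]}     p         t = (s≤s z≤n ∷ []) , [-]
push-partition (suc m) {x ∷ xs} (pos , l) t = (s≤s z≤n ∷ pos) , (t ∷ l)

push-pop : ∀ {xs} → IsPartition xs → push (top xs) (pop xs) ≡ xs
push-pop {[]}         p              = refl
push-pop {suc x ∷ xs} p              = refl
push-pop {zero ∷ xs}  ((() ∷ _) , _)

pop-push : ∀ M {xs} → IsPartition xs → top xs ≤ M → pop (push M xs) ≡ xs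
pop-push zero    p t rewrite top≤0 p t = refl
pop-push (suc m) p t = refl

top-push : ∀ M {xs} → IsPartition xs → top xs ≤ M → top (push M xs) ≡ M
top-push zero    p t rewrite top≤0 p t = refl
top-push (suc m) p t = refl

Interlace : ℕ → List ℕ → List ℕ → Set
Interlace s xs ys = ∀ j → part ys (j + s) ≤ part xs j

-- Dropping the first part of the left row increases the shift by one, and dropping that of the
-- right row decreases it: this is the change of profile c - e_i + e_(i+1). In the converse, the
-- restored index 0 on the left needs its own inequality.
interlace-popˡ : ∀ {s} xs ys → Interlace s xs ys → Interlace (suc s) (pop xs) ys
interlace-popˡ {s} xs ys i j = ≡.subst₂ (λ l m → part ys l ≤ m) (sym (ℕ.+-suc j s)) (sym (part-pop xs j)) (i (suc j))

interlace-popʳ : ∀ {s} xs ys → Interlace (suc s) xs ys → Interlace s xs (pop ys)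
interlace-popʳ {s} xs ys i j = subst (_≤ part xs j) (trans (cong (part ys) (ℕ.+-suc j s)) (sym (part-pop ys (j + s)))) (i j)

interlace-unpopˡ : ∀ {s} xs ys → part ys s ≤ top xs → Interlace (suc s) (pop xs) ys → Interlace s xs ys
interlace-unpopˡ {s} xs ys t i zero    = t
interlace-unpopˡ {s} xs ys t i (suc j) = ≡.subst₂ (λ l m → part ys l ≤ m) (ℕ.+-suc j s) (part-pop xs j) (i j)

interlace-unpopʳ : ∀ {s} xs ys → Interlace s xs (pop ys) → Interlace (suc s) xs ys
interlace-unpopʳ {s} xs ys i j = subst (_≤ part xs j) (trans (part-pop ys (j + s)) (cong (part ys) (sym (ℕ.+-suc j s)))) (i j)

-- Pairs (M, Λ): rotation, removal of a part M, lowering of M.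

record BoundedRows (c₁ c₂ c₃ c₄ k n M : ℕ) (a b c d : List ℕ) : Set where
  constructor cyl
  field
    pa  : IsPartition a
    pb  : IsPartition b
    pc  : IsPartition c
    pd  : IsPartition d
    ab  : Interlace c₂ a b
    bc  : Interlace c₃ b c
    cd  : Interlace c₄ c d
    da  : Interlace c₁ d a
    a≤M : top a ≤ M
    b≤M : top b ≤ M
    c≤M : top c ≤ M
    d≤M : top d ≤ M
    weight : k * M + size (a ∷ b ∷ c ∷ d ∷ []) ≡ n

-- Pairs (M , Λ) with all parts of Λ at most M, weighted by q^(kM + |Λ|).
Bounded : (c₁ c₂ c₃ c₄ k n : ℕ) → ℕ × Rows 4 → Set
Bounded c₁ c₂ c₃ c₄ k n (M , a ∷ b ∷ c ∷ d ∷ []) = BoundedRows c₁ c₂ c₃ c₄ k n M a b c d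

Top₁ Top₂ Top₃ : ℕ × Rows 4 → Set
Top₁ (M , a ∷ b ∷ c ∷ d ∷ []) = top a ≡ M
Top₂ (M , a ∷ b ∷ c ∷ d ∷ []) = top b ≡ M
Top₃ (M , a ∷ b ∷ c ∷ d ∷ []) = top c ≡ M

rotate : ℕ × Rows 4 → ℕ × Rows 4
rotate (M , a ∷ b ∷ c ∷ d ∷ []) = M , b ∷ c ∷ d ∷ a ∷ []

rotate⁻¹ : ℕ × Rows 4 → ℕ × Rows 4
rotate⁻¹ (M , a ∷ b ∷ c ∷ d ∷ []) = M , d ∷ a ∷ b ∷ c ∷ []

module _ {c₁ c₂ c₃ c₄ k n : ℕ} where

  enum-rotate : ∀ {K z} → Enum (Bounded c₁ c₂ c₃ c₄ k n ∩ K) z → Enum (Bounded c₂ c₃ c₄ c₁ k n ∩ (K ∘ rotate⁻¹)) z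
  enum-rotate {K} = enum-map rotate rotate⁻¹
    (λ { {M , a ∷ b ∷ c ∷ d ∷ []} (cyl pa pb pc pd ab bc cd da a≤M b≤M c≤M d≤M w , h) →
         cyl pb pc pd pa bc cd da ab b≤M c≤M d≤M a≤M (trans (cong (_+_ (k * M)) (cycle (ℕ.sum b) (ℕ.sum c) (ℕ.sum d) (ℕ.sum a))) w) , h })
    (λ { {M , b ∷ c ∷ d ∷ a ∷ []} (cyl pb pc pd pa bc cd da ab b≤M c≤M d≤M a≤M w , h) →
         cyl pa pb pc pd ab bc cd da a≤M b≤M c≤M d≤M (trans (cong (_+_ (k * M)) (sym (cycle (ℕ.sum b) (ℕ.sum c) (ℕ.sum d) (ℕ.sum a)))) w) , h })
    (λ { {M , a ∷ b ∷ c ∷ d ∷ []} _ → refl })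
    (λ { {M , a ∷ b ∷ c ∷ d ∷ []} _ → refl })
    where
    cycle : ∀ b c d a → b + (c + (d + (a + 0))) ≡ a + (b + (c + (d + 0)))
    cycle = solve-∀

enum-condition : ∀ {c₁ c₂ c₃ c₄ k n K K′ z} →
  (∀ {M a b c d} → K (M , a ∷ b ∷ c ∷ d ∷ []) → K′ (M , a ∷ b ∷ c ∷ d ∷ [])) →
  (∀ {M a b c d} → K′ (M , a ∷ b ∷ c ∷ d ∷ []) → K (M , a ∷ b ∷ c ∷ d ∷ [])) →
  Enum (Bounded c₁ c₂ c₃ c₄ k n ∩ K) z → Enum (Bounded c₁ c₂ c₃ c₄ k n ∩ K′) z
enum-condition to from = enum-⇔
  (λ { {M , a ∷ b ∷ c ∷ d ∷ []} (t , h) → t , to h })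
  (λ { {M , a ∷ b ∷ c ∷ d ∷ []} (t , h) → t , from h })

pushRow popRow : ℕ × Rows 4 → ℕ × Rows 4
pushRow (M , a ∷ r) = M , push M a ∷ r
popRow  (M , a ∷ r) = M , pop a ∷ r

popRow-pushRow : ∀ {c₁ c₂ c₃ c₄ k n e} → Bounded c₁ c₂ c₃ c₄ k n e → popRow (pushRow e) ≡ e
popRow-pushRow {e = M , a ∷ b ∷ c ∷ d ∷ []} t = cong (λ a → M , a ∷ b ∷ c ∷ d ∷ []) (pop-push M (BoundedRows.pa t) (BoundedRows.a≤M t))

pushRow-popRow : ∀ {c₁ c₂ c₃ c₄ k n e} → Bounded c₁ c₂ c₃ c₄ k n e → Top₁ e → pushRow (popRow e) ≡ e
pushRow-popRow {e = M , a ∷ b ∷ c ∷ d ∷ []} t refl = cong (λ a → M , a ∷ b ∷ c ∷ d ∷ []) (push-pop (BoundedRows.pa t))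

module _ {c₁ c₂ c₃ c₄ k n : ℕ} where

  private
    regroup : ∀ k M s r → k * M + (M + s + r) ≡ suc k * M + (s + r)
    regroup = solve-∀

  push-Bounded : ∀ {e} → Bounded c₁ (suc c₂) c₃ c₄ (suc k) n e → Bounded (suc c₁) c₂ c₃ c₄ k n (pushRow e) × Top₁ (pushRow e)
  push-Bounded {M , a ∷ b ∷ c ∷ d ∷ []} (cyl pa pb pc pd ab bc cd da a≤M b≤M c≤M d≤M w) =
    cyl (push-partition M pa a≤M) pb pc pd
      -- The restored index 0 holds M, which bounds every part of the next row.
      (interlace-unpopˡ (push M a) b (subst (part b c₂ ≤_) (sym new-top) (ℕ.≤-trans (part≤top pb c₂) b≤M))
        (subst (λ x → Interlace (suc c₂) x b) (sym new-pop) ab))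
      bc cd
      (interlace-unpopʳ d (push M a) (subst (Interlace c₁ d) (sym new-pop) da))
      (ℕ.≤-reflexive new-top) b≤M c≤M d≤M
      (trans (cong (λ s → k * M + (s + rest)) (trans (sum-pop (push M a)) (cong₂ (λ x y → x + ℕ.sum y) new-top new-pop)))
        (trans (regroup k M (ℕ.sum a) rest) w))
    , new-top
    where
    rest = size (b ∷ c ∷ d ∷ [])
    new-top : top (push M a) ≡ M
    new-top = top-push M pa a≤M
    new-pop : pop (push M a) ≡ a
    new-pop = pop-push M pa a≤M

  pop-Bounded : ∀ {e} → Bounded (suc c₁) c₂ c₃ c₄ k n e → Top₁ e → Bounded c₁ (suc c₂) c₃ c₄ (suc k) n (popRow e)
  pop-Bounded {M , a ∷ b ∷ c ∷ d ∷ []} (cyl pa pb pc pd ab bc cd da a≤M b≤M c≤M d≤M w) refl =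
    cyl (pop-partition pa) pb pc pd (interlace-popˡ a b ab) bc cd (interlace-popʳ d a da)
      (top-pop pa) b≤M c≤M d≤M
      (trans (sym (regroup k M (ℕ.sum (pop a)) rest)) (trans (cong (λ s → k * M + (s + rest)) (sym (sum-pop a))) w))
    where rest = size (b ∷ c ∷ d ∷ [])

  -- Removing the largest part M of the first row moves one unit of the profile from c₁ to c₂
  -- and one M from the size to the weight.
  enum-push : ∀ {K z} → Enum (Bounded c₁ (suc c₂) c₃ c₄ (suc k) n ∩ (K ∘ pushRow)) z →
              Enum (Bounded (suc c₁) c₂ c₃ c₄ k n ∩ (Top₁ ∩ K)) z
  enum-push {K} = enum-map pushRow popRow
    (λ (t , h) → let t′ , r = push-Bounded t in t′ , r , h)
    (λ (t , r , h) → pop-Bounded t r , subst K (sym (pushRow-popRow t r)) h)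
    (λ (t , _) → popRow-pushRow t)
    (λ (t , r , _) → pushRow-popRow t r)

raise lower : ℕ × Rows 4 → ℕ × Rows 4
raise (M , Λ) = suc M , Λ
lower (M , Λ) = M ∸ 1 , Λ

Below : ℕ × Rows 4 → Set
Below (M , a ∷ b ∷ c ∷ d ∷ []) = top a < M × top b < M × top c < M × top d < M

-- If every row starts below M, then M can be lowered by one, at a gain of k in weight; this gives
-- the summand q^k F(k).
enum-raise : ∀ {c₁ c₂ c₃ c₄ k n z} → Enum (Bounded c₁ c₂ c₃ c₄ k n) z → Enum (Bounded c₁ c₂ c₃ c₄ k (k + n) ∩ Below) z
enum-raise {k = k} = enum-map raise lower
  (λ { {M , a ∷ b ∷ c ∷ d ∷ []} (cyl pa pb pc pd ab bc cd da a≤M b≤M c≤M d≤M w) →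
       cyl pa pb pc pd ab bc cd da (ℕ.m≤n⇒m≤1+n a≤M) (ℕ.m≤n⇒m≤1+n b≤M) (ℕ.m≤n⇒m≤1+n c≤M) (ℕ.m≤n⇒m≤1+n d≤M)
         (trans (regroup k M (size (a ∷ b ∷ c ∷ d ∷ []))) (cong (_+_ k) w))
       , s≤s a≤M , s≤s b≤M , s≤s c≤M , s≤s d≤M })
  (λ { {suc M , a ∷ b ∷ c ∷ d ∷ []} (cyl pa pb pc pd ab bc cd da _ _ _ _ w , s≤s a≤M , s≤s b≤M , s≤s c≤M , s≤s d≤M) →
       cyl pa pb pc pd ab bc cd da a≤M b≤M c≤M d≤M
         (ℕ.+-cancelˡ-≡ k _ _ (trans (sym (regroup k M (size (a ∷ b ∷ c ∷ d ∷ [])))) w)) })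
  (λ _ → refl)
  (λ { {suc M , a ∷ b ∷ c ∷ d ∷ []} _ → refl ; {zero , a ∷ b ∷ c ∷ d ∷ []} (_ , () , _) })
  where
  regroup : ∀ k M s → k * suc M + s ≡ k + (k * M + s)
  regroup = solve-∀

positive-weight : ∀ {k n} M s → n < k → k * M + s ≡ n → M ≡ 0
positive-weight             zero    s n<k w = refl
positive-weight {k} {n} (suc M) s n<k w =
  contradiction n<k (ℕ.≤⇒≯ (subst (k ≤_) w (ℕ.≤-trans (ℕ.m≤m*n k (suc M)) (ℕ.m≤m+n _ s))))

enum-∅ : ∀ {A : Set} {P : A → Set} → (∀ {a} → ¬ P a) → Enum P 0ℤ
enum-∅ ¬P = [] , [] , [] , (λ a p → contradiction p ¬P) , refl

enum-below-empty : ∀ {c₁ c₂ c₃ c₄ k n} → n < k → Enum (Bounded c₁ c₂ c₃ c₄ k n ∩ Below) 0ℤ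
enum-below-empty n<k = enum-∅ λ { {zero , a ∷ b ∷ c ∷ d ∷ []} (_ , () , _)
  ; {suc M , a ∷ b ∷ c ∷ d ∷ []} (t , _) → case positive-weight (suc M) (size (a ∷ b ∷ c ∷ d ∷ [])) n<k (BoundedRows.weight t) of λ () }

-- A positive M already costs k > n, so M = 0 and all rows are empty: F(k) is 1 modulo q^k.
enum-far : ∀ {c₁ c₂ c₃ c₄ k n} → n < k → Enum (Bounded c₁ c₂ c₃ c₄ k n) (𝟙 n)
enum-far {k = k} {zero} n<k =
  (0 , nil) ∷ [] , ([] ∷ []) , (empty-Bounded ∷ [])
  , (λ { (M , a ∷ b ∷ c ∷ d ∷ []) t → here (empty-unique t) }) , refl
  where
  nil : Rows 4
  nil = [] ∷ [] ∷ [] ∷ [] ∷ []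
  empty : IsPartition []
  empty = [] , []
  empty-Bounded : Bounded _ _ _ _ k 0 (0 , nil)
  empty-Bounded = cyl empty empty empty empty (λ _ → z≤n) (λ _ → z≤n) (λ _ → z≤n) (λ _ → z≤n) z≤n z≤n z≤n z≤n
    (trans (ℕ.+-identityʳ (k * 0)) (ℕ.*-zeroʳ k))
  empty-unique : ∀ {M a b c d} → Bounded _ _ _ _ k 0 (M , a ∷ b ∷ c ∷ d ∷ []) → (M , a ∷ b ∷ c ∷ d ∷ []) ≡ (0 , nil)
  empty-unique {M} {a} {b} {c} {d} (cyl pa pb pc pd ab bc cd da a≤M b≤M c≤M d≤M w)
    rewrite positive-weight M (size (a ∷ b ∷ c ∷ d ∷ [])) n<k w
          | top≤0 pa a≤M | top≤0 pb b≤M | top≤0 pc c≤M | top≤0 pd d≤M = refl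
enum-far {k = k} {suc n} n<k = enum-∅ λ { {M , a ∷ b ∷ c ∷ d ∷ []} t → nonempty t }
  where
  nonempty : ∀ {M a b c d} → ¬ Bounded _ _ _ _ k (suc n) (M , a ∷ b ∷ c ∷ d ∷ [])
  nonempty {M} {a} {b} {c} {d} (cyl pa pb pc pd ab bc cd da a≤M b≤M c≤M d≤M w)
    with positive-weight M (size (a ∷ b ∷ c ∷ d ∷ [])) n<k w
  ... | refl with top≤0 pa a≤M | top≤0 pb b≤M | top≤0 pc c≤M | top≤0 pd d≤M
  ... | refl | refl | refl | refl with trans (sym w) (trans (ℕ.+-identityʳ (k * 0)) (ℕ.*-zeroʳ k))
  ... | ()

-- Inclusion-exclusion over the rows that start with M.

top₁? : Decidable Top₁
top₁? (M , a ∷ b ∷ c ∷ d ∷ []) = top a ℕ.≟ M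

top₂? : Decidable Top₂
top₂? (M , a ∷ b ∷ c ∷ d ∷ []) = top b ℕ.≟ M

top₃? : Decidable Top₃
top₃? (M , a ∷ b ∷ c ∷ d ∷ []) = top c ℕ.≟ M

enum-top₁ : ∀ {c₁ c₂ c₃ c₄ k n z} → Enum (Bounded c₁ (suc c₂) c₃ c₄ (suc k) n) z → Enum (Bounded (suc c₁) c₂ c₃ c₄ k n ∩ Top₁) z
enum-top₁ e = enum-⇔ (λ (t , r , _) → t , r) (λ (t , r) → t , r , tt) (enum-push {K = Always} (enum-always e))

enum-rotate-all : ∀ {c₁ c₂ c₃ c₄ k n z} → Enum (Bounded c₁ c₂ c₃ c₄ k n) z → Enum (Bounded c₂ c₃ c₄ c₁ k n) z
enum-rotate-all e = enum-⇔ proj₁ (_, tt) (enum-rotate {K = Always} (enum-always e))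

enum-top₁→₃ : ∀ {c₁ c₂ c₃ c₄ k n z} → Enum (Bounded c₁ c₂ c₃ c₄ k n ∩ Top₁) z → Enum (Bounded c₃ c₄ c₁ c₂ k n ∩ Top₃) z
enum-top₁→₃ e = enum-condition {K′ = Top₃} (λ r → r) (λ r → r)
  (enum-rotate {K = Top₁ ∘ rotate⁻¹} (enum-rotate {K = Top₁} e))

enum-top₁→₂ : ∀ {c₁ c₂ c₃ c₄ k n z} → Enum (Bounded c₁ c₂ c₃ c₄ k n ∩ Top₁) z → Enum (Bounded c₄ c₁ c₂ c₃ k n ∩ Top₂) z
enum-top₁→₂ e = enum-condition {K′ = Top₂} (λ r → r) (λ r → r)
  (enum-rotate {K = Top₁ ∘ rotate⁻¹ ∘ rotate⁻¹} (enum-rotate {K = Top₁ ∘ rotate⁻¹} (enum-rotate {K = Top₁} e)))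

-- Removing M from row 1 gives (0,1,1,0), a rotation of B; row 3 is alike, since two rotations fix
-- the profile. Removing both gives (0,1,0,1), a rotation of A, and raises k by 2.
tops-A : ∀ {k n x y} → Enum (Bounded 1 1 0 0 (1 + k) n) x → Enum (Bounded 1 0 1 0 (2 + k) n) y →
         Enum (Bounded 1 0 1 0 k n ∩ (Top₁ ∪ Top₃)) (x ℤ.+ (x ℤ.- y))
tops-A {k} {n} {x} {y} eB eA = enum-∪ top₁? first (enum-top₁→₃ first) both
  where
  first : Enum (Bounded 1 0 1 0 k n ∩ Top₁) x
  first = enum-top₁ (enum-rotate-all (enum-rotate-all (enum-rotate-all eB)))
  both : Enum (Bounded 1 0 1 0 k n ∩ (Top₁ ∩ Top₃)) y
  both = enum-push {K = Top₃} (enum-condition {K = Top₃} (λ r → r) (λ r → r)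
    (enum-top₁→₃ (enum-top₁ (enum-rotate-all eA))))

-- Row 1 gives (0,2,0,0), a rotation of C; row 2 gives (1,0,1,0), which is A; both together give
-- (0,1,1,0), a rotation of B.
tops-B : ∀ {k n x y z} → Enum (Bounded 1 0 1 0 (1 + k) n) x → Enum (Bounded 2 0 0 0 (1 + k) n) y → Enum (Bounded 1 1 0 0 (2 + k) n) z →
         Enum (Bounded 1 1 0 0 k n ∩ (Top₁ ∪ Top₂)) (y ℤ.+ (x ℤ.- z))
tops-B {k} {n} {x} {y} {z} eA eC eB = enum-∪ top₁? first (enum-top₁→₂ (enum-top₁ (enum-rotate-all eA))) both
  where
  first : Enum (Bounded 1 1 0 0 k n ∩ Top₁) y
  first = enum-top₁ (enum-rotate-all (enum-rotate-all (enum-rotate-all eC)))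
  both : Enum (Bounded 1 1 0 0 k n ∩ (Top₁ ∩ Top₂)) z
  both = enum-push {K = Top₂} (enum-condition {K = Top₂} (λ r → r) (λ r → r)
    (enum-top₁→₂ (enum-top₁ eB)))

enum-top-or-below : ∀ {c₁ c₂ c₃ c₄ k n R x y} → Decidable R →
  (∀ {e} → R e → ¬ Below e) → (∀ {e} → Bounded c₁ c₂ c₃ c₄ k n e → ¬ R e → Below e) →
  Enum (Bounded c₁ c₂ c₃ c₄ k n ∩ Below) x → Enum (Bounded c₁ c₂ c₃ c₄ k n ∩ R) y → Enum (Bounded c₁ c₂ c₃ c₄ k n) (x ℤ.+ y)
enum-top-or-below {R = R} R? disjoint otherwise below tops =
  enum-⊎ below tops (λ (_ , b) (_ , r) → disjoint r b) proj₁ proj₁ split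
  where
  split : ∀ {e} → Bounded _ _ _ _ _ _ e → (Bounded _ _ _ _ _ _ ∩ Below) e ⊎ (Bounded _ _ _ _ _ _ ∩ R) e
  split {e} t with R? e
  ... | yes r = inj₂ (t , r)
  ... | no ¬r = inj₁ (t , otherwise t ¬r)

top₁-¬below : ∀ {e} → Top₁ e → ¬ Below e
top₁-¬below {M , a ∷ b ∷ c ∷ d ∷ []} r (l , _) = ℕ.<⇒≢ l r

top₂-¬below : ∀ {e} → Top₂ e → ¬ Below e
top₂-¬below {M , a ∷ b ∷ c ∷ d ∷ []} r (_ , l , _) = ℕ.<⇒≢ l r

top₃-¬below : ∀ {e} → Top₃ e → ¬ Below e
top₃-¬below {M , a ∷ b ∷ c ∷ d ∷ []} r (_ , _ , l , _) = ℕ.<⇒≢ l r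

-- A row with c_i = 0 starts no higher than the row before it, so only rows with c_i > 0 need
-- comparing with M.
below-A : ∀ {k n e} → Bounded 1 0 1 0 k n e → ¬ (Top₁ ∪ Top₃) e → Below e
below-A {e = M , a ∷ b ∷ c ∷ d ∷ []} t ¬r =
  a<M , ℕ.≤-<-trans (BoundedRows.ab t 0) a<M , c<M , ℕ.≤-<-trans (BoundedRows.cd t 0) c<M
  where
  a<M = ℕ.≤∧≢⇒< (BoundedRows.a≤M t) (¬r ∘ inj₁)
  c<M = ℕ.≤∧≢⇒< (BoundedRows.c≤M t) (¬r ∘ inj₂)

below-B : ∀ {k n e} → Bounded 1 1 0 0 k n e → ¬ (Top₁ ∪ Top₂) e → Below e
below-B {e = M , a ∷ b ∷ c ∷ d ∷ []} t ¬r = a<M , b<M , c<M , ℕ.≤-<-trans (BoundedRows.cd t 0) c<M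
  where
  a<M = ℕ.≤∧≢⇒< (BoundedRows.a≤M t) (¬r ∘ inj₁)
  b<M = ℕ.≤∧≢⇒< (BoundedRows.b≤M t) (¬r ∘ inj₂)
  c<M = ℕ.≤-<-trans (BoundedRows.bc t 0) b<M

below-C : ∀ {k n e} → Bounded 2 0 0 0 k n e → ¬ Top₁ e → Below e
below-C {e = M , a ∷ b ∷ c ∷ d ∷ []} t ¬r = a<M , b<M , c<M , ℕ.≤-<-trans (BoundedRows.cd t 0) c<M
  where
  a<M = ℕ.≤∧≢⇒< (BoundedRows.a≤M t) ¬r
  b<M = ℕ.≤-<-trans (BoundedRows.ab t 0) a<M
  c<M = ℕ.≤-<-trans (BoundedRows.bc t 0) b<M

enum-A : ∀ {k n x y z} → Enum (Bounded 1 0 1 0 k n ∩ Below) z → Enum (Bounded 1 1 0 0 (1 + k) n) x → Enum (Bounded 1 0 1 0 (2 + k) n) y →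
         Enum (Bounded 1 0 1 0 k n) (z ℤ.+ (x ℤ.+ (x ℤ.- y)))
enum-A below eB eA = enum-top-or-below (λ e → top₁? e ⊎-dec top₃? e) [ top₁-¬below , top₃-¬below ]′ below-A below (tops-A eB eA)

enum-B : ∀ {k n w x y z} → Enum (Bounded 1 1 0 0 k n ∩ Below) w →
         Enum (Bounded 1 0 1 0 (1 + k) n) x → Enum (Bounded 2 0 0 0 (1 + k) n) y → Enum (Bounded 1 1 0 0 (2 + k) n) z →
         Enum (Bounded 1 1 0 0 k n) (w ℤ.+ (y ℤ.+ (x ℤ.- z)))
enum-B below eA eC eB = enum-top-or-below (λ e → top₁? e ⊎-dec top₂? e) [ top₁-¬below , top₂-¬below ]′ below-B below (tops-B eA eC eB)

enum-C : ∀ {k n x y} → Enum (Bounded 2 0 0 0 k n ∩ Below) x → Enum (Bounded 1 1 0 0 (1 + k) n) y → Enum (Bounded 2 0 0 0 k n) (x ℤ.+ y)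
enum-C below eB = enum-top-or-below top₁? top₁-¬below below-C below (enum-top₁ eB)

-- At k = 0 the bound M is free of weight, and requiring row 1 or row 3 to start with M forces M to
-- be the largest part of Λ, because rows 2 and 4 start no higher. So each Λ occurs exactly once.
forget : ∀ {N z} → Enum (Bounded 1 0 1 0 0 N ∩ (Top₁ ∪ Top₃)) z →
         Enum (λ Λ → IsCylindric profile Λ × size Λ ≡ N) z
forget {N} = enum-map proj₂ with-max (λ {e} → to {e}) (λ {Λ} → from {Λ})
  (λ { {M , a ∷ b ∷ c ∷ d ∷ []} (t , r) → cong (_, _) (max-is-M (BoundedRows.a≤M t) (BoundedRows.c≤M t) r) })
  (λ { {a ∷ b ∷ c ∷ d ∷ []} _ → refl })
  where
  with-max : Rows 4 → ℕ × Rows 4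
  with-max (a ∷ b ∷ c ∷ d ∷ []) = top a ⊔ top c , a ∷ b ∷ c ∷ d ∷ []

  max-is-M : ∀ {l m M} → l ≤ M → m ≤ M → l ≡ M ⊎ m ≡ M → l ⊔ m ≡ M
  max-is-M l≤M m≤M (inj₁ refl) = ℕ.m≥n⇒m⊔n≡m m≤M
  max-is-M l≤M m≤M (inj₂ refl) = ℕ.m≤n⇒m⊔n≡n l≤M

  to : ∀ {e} → (Bounded 1 0 1 0 0 N ∩ (Top₁ ∪ Top₃)) e → IsCylindric profile (proj₂ e) × size (proj₂ e) ≡ N
  to {M , a ∷ b ∷ c ∷ d ∷ []} (cyl pa pb pc pd ab bc cd da _ _ _ _ w , _) =
    ((λ { zero → pa ; (suc zero) → pb ; (suc (suc zero)) → pc ; (suc (suc (suc zero))) → pd })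
    , λ { zero → ab ; (suc zero) → bc ; (suc (suc zero)) → cd ; (suc (suc (suc zero))) → da })
    , w

  from : ∀ {Λ} → IsCylindric profile Λ × size Λ ≡ N → (Bounded 1 0 1 0 0 N ∩ (Top₁ ∪ Top₃)) (with-max Λ)
  from {a ∷ b ∷ c ∷ d ∷ []} ((p , i) , w) =
    cyl (p zero) (p (suc zero)) (p (suc (suc zero))) (p (suc (suc (suc zero))))
      (i zero) (i (suc zero)) (i (suc (suc zero))) (i (suc (suc (suc zero))))
      a≤ (ℕ.≤-trans (i zero 0) a≤) c≤ (ℕ.≤-trans (i (suc (suc zero)) 0) c≤) w
    , [ inj₁ ∘ sym , inj₂ ∘ sym ]′ (ℕ.⊔-sel (top a) (top c))
    where
    a≤ = ℕ.m≤m⊔n (top a) (top c)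
    c≤ = ℕ.m≤n⊔m (top a) (top c)

-- Matching the counts with the coefficients of the series.

＋-coeff : ∀ f g n → (f ＋ g) n ≡ f n ℤ.+ g n
＋-coeff f g n = cong (λ h → h n) (＋-def f g)

μ-·-coeff : ∀ k f n → (μ 1ℤ k · f) (k + n) ≡ f n
μ-·-coeff k f n rewrite μ-def 1ℤ k | ·-def (mono 1ℤ k) f = mono-⊗-+ k f n

μ-·-coeff-< : ∀ {k n} f → n < k → (μ 1ℤ k · f) n ≡ 0ℤ
μ-·-coeff-< {k} f n<k rewrite μ-def 1ℤ k | ·-def (mono 1ℤ k) f = mono-⊗-< 1ℤ f n<k

-- As `suc k` is positive, coefficient n of q^(k+1) f involves only a smaller coefficient of f, or
-- none; hence counts for m < n suffice.
enum-below : ∀ {c₁ c₂ c₃ c₄} k n {f} → (∀ {m} → m < n → Enum (Bounded c₁ c₂ c₃ c₄ (suc k) m) (f m)) →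
             Enum (Bounded c₁ c₂ c₃ c₄ (suc k) n ∩ Below) ((μ 1ℤ (suc k) · f) n)
enum-below {c₁} {c₂} {c₃} {c₄} k n {f} e with n ℕ.<? suc k
... | yes n<k = enum-≡ (sym (μ-·-coeff-< f n<k)) (enum-below-empty n<k)
... | no  n≮k = subst (λ m → Enum (Bounded c₁ c₂ c₃ c₄ (suc k) m ∩ Below) ((μ 1ℤ (suc k) · f) m))
  (ℕ.m+[n∸m]≡n k<n)
  (enum-≡ (sym (μ-·-coeff (suc k) f (n ∸ suc k)))
    (enum-raise (e (ℕ.∸-monoʳ-< {n} {suc k} {0} (s≤s z≤n) k<n))))
  where k<n = ℕ.≮⇒≥ n≮k

module Counting (N : ℕ) where
  open Truncated N
  open CommutativeRing (truncatedRing N) using (_≈_)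

  private
    solve-left : ∀ {a b c} → a ℤ.+ b ≡ c → a ≡ c ℤ.- b
    solve-left {a} {b} refl = cancel a b
      where
      cancel : ∀ a b → a ≡ a ℤ.+ b ℤ.- b
      cancel = ℤSolver.solve-∀

  -- Solves for the coefficient of f in the exact shape that `enum-A` and `enum-B` produce.
  coeff-step : ∀ {f g s h i n} → n ≤ N → f ＋ g ≈ s ＋ (h ＋ i) → f n ≡ s n ℤ.+ (i n ℤ.+ (h n ℤ.- g n))
  coeff-step {f} {g} {s} {h} {i} {n} n≤N e = trans (solve-left (trans (sym (＋-coeff f g n)) (trans (at e n≤N)
    (trans (＋-coeff s (h ＋ i) n) (cong (ℤ._+_ (s n)) (＋-coeff h i n)))))) (regroup (s n) (h n) (i n) (g n))
    where
    regroup : ∀ s h i g → s ℤ.+ (h ℤ.+ i) ℤ.- g ≡ s ℤ.+ (i ℤ.+ (h ℤ.- g))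
    regroup = ℤSolver.solve-∀

  Counts : ℕ → ℕ → Set
  Counts j n = Enum (Bounded 1 0 1 0 (suc j) n) (φA j n) × Enum (Bounded 1 1 0 0 (suc j) n) (φB j n) × Enum (Bounded 2 0 0 0 (suc j) n) (φC j n)

  counts-far : ∀ {j n} → N < j → n ≤ N → Counts j n
  counts-far {j} {n} N<j n≤N =
    enum-≡ (sym (at (φA-far N<j) n≤N)) (enum-far n<k) , enum-≡ (sym (at (φB-far N<j) n≤N)) (enum-far n<k) ,
    enum-≡ (sym (at (φC-far N<j) n≤N)) (enum-far n<k)
    where
    n<k : n < suc j
    n<k = s≤s (ℕ.≤-trans n≤N (ℕ.<⇒≤ N<j))

  counts-step : ∀ {j n} → n ≤ N → (∀ {m} → m < n → Counts j m) → Counts (1 + j) n → Counts (2 + j) n → Counts j n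
  counts-step {j} {n} n≤N below (eA₁ , eB₁ , eC₁) (eA₂ , eB₂ , _) =
    enum-≡ (sym (coeff-step n≤N (φA-step j))) (enum-A (enum-below j n (λ m<n → proj₁ (below m<n))) eB₁ eA₂) ,
    enum-≡ (sym (coeff-step n≤N (φB-step j))) (enum-B (enum-below j n (λ m<n → proj₁ (proj₂ (below m<n)))) eA₁ eC₁ eB₂) ,
    enum-≡ (sym (trans (at (φC-step j) n≤N) (＋-coeff (x (suc j) · φC j) (φB (suc j)) n)))
      (enum-C (enum-below j n (λ m<n → proj₂ (proj₂ (below m<n)))) eB₁)

  -- Downward induction on j, starting from j > N where only (0 , ∅) has weight at most N.
  counts : ∀ d j → N < d + j → ∀ b {n} → n < b → n ≤ N → Counts j n
  counts zero    j N<j b       n<b       n≤N = counts-far N<j n≤N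
  -- Here d bounds the distance of j from the range beyond N, and b bounds n: the lowered pairs
  -- reduce n at the same j, the other counts raise j at the same n.
  counts (suc d) j N<d (suc b) (s≤s n≤b) n≤N = counts-step n≤N
    (λ m<n → counts (suc d) j N<d b (ℕ.<-≤-trans m<n n≤b) (ℕ.≤-trans (ℕ.<⇒≤ m<n) n≤N))
    (counts d (1 + j) N<d₁ (suc b) (s≤s n≤b) n≤N)
    (counts d (2 + j) (ℕ.≤-trans N<d₁ (ℕ.+-monoʳ-≤ d (ℕ.n≤1+n (1 + j)))) (suc b) (s≤s n≤b) n≤N)
    where
    N<d₁ : N < d + suc j
    N<d₁ = subst (N <_) (sym (ℕ.+-suc d j)) N<d

  counts-all : ∀ j → Counts j N
  counts-all j = counts (suc N) j (s≤s (ℕ.m≤m+n N j)) (suc N) ℕ.≤-refl ℕ.≤-refl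

  -- The identity `A-J` at 0, arranged like the result of `tops-A` at k = 0.
  rhs-coefficient : rhs N ≡ φB 0 N ℤ.+ (φB 0 N ℤ.- φA 1 N)
  rhs-coefficient = trans (at (rhs-≈ N) ℕ.≤-refl) (trans
    (solve-left (trans (sym (＋-coeff (A 0 · J 0) (φA 1) N)) (trans (at (A-J 0) ℕ.≤-refl) (＋-coeff (φB 0) (φB 0) N))))
    (ℤ.+-assoc (φB 0 N) (φB 0 N) (ℤ.- φA 1 N)))

theorem5p5 : (N : ℕ) → Σ (List (Vec (List ℕ) 4)) (λ xs →
    Unique xs
  × All (λ Λ → IsCylindric profile Λ × size Λ ≡ N) xs
  × ((Λ : Vec (List ℕ) 4) → IsCylindric profile Λ → size Λ ≡ N → Λ ∈ xs)
  × (+ length xs ≡ rhs N))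
theorem5p5 N =
  let open Counting N
      xs , unique , sound , complete , card =
        -- By the index shift, `counts-all 0` supplies F_B(1) and `counts-all 1` supplies F_A(2).
        forget (enum-≡ (sym rhs-coefficient) (tops-A (proj₁ (proj₂ (counts-all 0))) (proj₁ (counts-all 1))))
  in xs , unique , sound , (λ Λ cylindric size≡N → complete Λ (cylindric , size≡N)) , card
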